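{- For $n\ge 0$ let $Q_n$ be the lattice of order ideals of the shifted staircase poset $\{(i,j):1\le i\le j\le n\}$ (componentwise order). Then, as formal power series in $x$, \[\sum_{n=0}^\infty d(Q_n)\,x^n = \frac{8x\left(1+\sqrt{1-4x}-x(3+\sqrt{1-4x})\right)}{(1-4x)(1-4x+\sqrt{1-4x})^3}.\]
   Context: For a finite connected graph $G=(V,E)$, with $d(p,q)$ the graph distance, the Wiener index is $d(G)=\sum_{(p,q)\in V\times V} d(p,q)$ (ordered pairs). For a finite poset $P$, $d(P)$ is the Wiener index of the Hasse diagram of $P$ (vertices the elements, edges the cover relations). Order ideals are ordered by inclusion. -}

module Defs where

open import Data.Bool using (Bool; true; false; _∧_; _∨_; not; if_then_else_)
open import Data.Nat as ℕ using (ℕ; zero; suc; _≤ᵇ_; _≡ᵇ_)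
open import Data.Integer as ℤ using (ℤ; +_)
open import Data.List using (List; []; _∷_; map; concatMap; upTo; length; _++_; foldr)
open import Data.Bool.ListAction using (all; any)
open import Data.Product using (_×_; _,_)

reach : {A : Set} → List A → (A → A → Bool) → (A → A → Bool) →
        ℕ → A → A → Bool
reach V eq adj zero    p q = eq p q
reach V eq adj (suc k) p q =
  reach V eq adj k p q ∨ any (λ r → adj p r ∧ reach V eq adj k r q) V

firstWith : (ℕ → Bool) → ℕ → List ℕ → ℕ
firstWith P d []       = d
firstWith P d (k ∷ ks) = if P k then k else firstWith P d ks

-- graph distance: least k with a walk of length k from p to q
-- (for connected graphs this is attained for some k < |V|)
dist : {A : Set} → List A → (A → A → Bool) → (A → A → Bool) → A → A → ℕ
dist V eq adj p q =
  firstWith (λ k → reach V eq adj k p q) (length V) (upTo (length V))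

sumℕ : List ℕ → ℕ
sumℕ = foldr ℕ._+_ 0

wiener : {A : Set} → List A → (A → A → Bool) → (A → A → Bool) → ℕ
wiener V eq adj = sumℕ (map (λ p → sumℕ (map (λ q → dist V eq adj p q) V)) V)

-- Shifted staircase {(i,j) : 1 ≤ i ≤ j ≤ n}, written 0-indexed as
-- {(i,j) : i ≤ j < n}, with componentwise order.

Elt : Set
Elt = ℕ × ℕ

staircase : ℕ → List Elt
staircase n = concatMap (λ j → map (λ i → (i , j)) (upTo (suc j))) (upTo n)

leqE : Elt → Elt → Bool
leqE (a , b) (c , d) = (a ≤ᵇ c) ∧ (b ≤ᵇ d)

eqE : Elt → Elt → Bool
eqE (a , b) (c , d) = (a ≡ᵇ c) ∧ (b ≡ᵇ d)

memE : Elt → List Elt → Bool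
memE x S = any (eqE x) S

subsets : {A : Set} → List A → List (List A)
subsets []       = [] ∷ []
subsets (x ∷ xs) = map (x ∷_) (subsets xs) ++ subsets xs

filterB : {A : Set} → (A → Bool) → List A → List A
filterB P []       = []
filterB P (x ∷ xs) = if P x then x ∷ filterB P xs else filterB P xs

isIdeal : ℕ → List Elt → Bool
isIdeal n S = all (λ x → all (λ y → not (leqE y x) ∨ memE y S) (staircase n)) S

ideals : ℕ → List (List Elt)
ideals n = filterB (isIdeal n) (subsets (staircase n))

subE : List Elt → List Elt → Bool
subE S T = all (λ x → memE x T) S

eqI : List Elt → List Elt → Bool
eqI S T = subE S T ∧ subE T S

properE : List Elt → List Elt → Bool
properE S T = subE S T ∧ not (subE T S)

covers : ℕ → List Elt → List Elt → Bool
covers n S T =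
  properE S T ∧ not (any (λ K → properE S K ∧ properE K T) (ideals n))

hasseAdj : ℕ → List Elt → List Elt → Bool
hasseAdj n S T = covers n S T ∨ covers n T S

dQ : ℕ → ℕ
dQ n = wiener (ideals n) eqI (hasseAdj n)

PS : Set
PS = ℕ → ℤ

sumℤ : List ℤ → ℤ
sumℤ = foldr ℤ._+_ (+ 0)

_⊕_ : PS → PS → PS
(f ⊕ g) k = f k ℤ.+ g k

_⊖_ : PS → PS → PS
(f ⊖ g) k = f k ℤ.- g k

_⊛_ : PS → PS → PS
(f ⊛ g) k = sumℤ (map (λ i → f i ℤ.* g (k ℕ.∸ i)) (upTo (suc k)))

infixl 6 _⊕_ _⊖_
infixl 7 _⊛_

cst : ℤ → PS
cst c zero    = c
cst c (suc k) = + 0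

X : PS
X zero          = + 0
X (suc zero)    = + 1
X (suc (suc k)) = + 0

genQ : PS
genQ n = + dQ n

module Submission where

-- An ideal is recorded by the number h k of its boxes on each diagonal j − i = k.  Since
-- h k − h (k + 1) is 0 or 1, these profiles are the tail counts of the 0/1 words of length n, and
-- the Hasse distance between two ideals is Σ_k |h k − h′ k|.  Splitting off the first letter of
-- each word gives d(Q_n) = 4 d(Q_{n−1}) + E_n, where E_n is the sum of ||w| − |v|| over all pairs of
-- words of length n.  As letters are added, ||w| − |v|| performs a reflected lazy walk, so
-- E_{n+1} = 4 E_n + 2 Z_n with Z_n the number of pairs of equal weight; the kernel method for that
-- walk gives Z = 1/√(1−4x), whence Σ d(Q_n) xⁿ = 2x (1−4x)^{−5/2}.

open import Defs
open import Algebra.Bundles using (CommutativeRing)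
import Algebra.Solver.Ring
open import Algebra.Solver.Ring.AlmostCommutativeRing
  using (AlmostCommutativeRing; fromCommutativeRing; _-Raw-AlmostCommutative⟶_; Induced-equivalence)
open import Data.Bool using (Bool; true; false; T; _∧_; _∨_; not)
open import Data.Bool.ListAction using (any)
open import Data.Bool.Properties using (T-∧; T-∨; T?)
open import Data.Empty using (⊥; ⊥-elim)
open import Data.Integer as ℤ using (ℤ; +_)
import Data.Integer.Properties as ℤₚ
import Data.Integer.Tactic.RingSolver as ℤ-Ring
open import Data.List using (List; []; _∷_; map; upTo; applyUpTo; length; _++_; filterᵇ)
open import Data.List.Properties using (map-∘; map-++; map-upTo; length-map; length-++)
open import Data.List.Membership.Propositional using (_∈_; find; lose)
open import Data.List.Membership.Propositional.Properties
  using (∈-map⁺; ∈-map⁻; ∈-++⁺ˡ; ∈-++⁺ʳ; ∈-++⁻; ∈-filter⁺; ∈-filter⁻; ∈-concatMap⁺; ∈-concatMap⁻;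
         ∈-upTo⁺; ∈-upTo⁻)
open import Data.List.Membership.Propositional.Properties.WithK using (unique∧set⇒bag)
open import Data.List.Relation.Binary.BagAndSetEquality using (∼bag⇒↭)
open import Data.List.Relation.Binary.Permutation.Propositional using (_↭_)
open import Data.List.Relation.Binary.Permutation.Propositional.Properties
  using (↭-length) renaming (map⁺ to ↭-map⁺)
open import Data.List.Relation.Unary.All as All using ([]; _∷_)
import Data.List.Relation.Unary.All.Properties as All
open import Data.List.Relation.Unary.AllPairs as AllPairs using ([]; _∷_)
import Data.List.Relation.Unary.AllPairs.Properties as AllPairs
open import Data.List.Relation.Unary.Any as Any using (here; there)
open import Data.List.Relation.Unary.Any.Properties using (any⁺; any⁻)
open import Data.List.Relation.Unary.Unique.Propositional using (Unique)
import Data.List.Relation.Unary.Unique.Propositional.Properties as Unique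
open import Data.Maybe using (just; nothing)
open import Data.Nat
  using (ℕ; zero; suc; _+_; _*_; _∸_; _^_; _≤_; _<_; _≤′_; ≤′-reflexive; ≤′-step; z≤n; s≤s; s≤s⁻¹;
         _<ᵇ_; _≤ᵇ_; _≡ᵇ_; ∣_-_∣)
open import Data.Nat.Induction using (<-rec)
open import Data.Nat.ListAction.Properties using (sum-↭; sum-++)
open import Data.Nat.Properties
import Data.Nat.Tactic.RingSolver as ℕ-Ring
open import Algebra.Properties.CommutativeSemigroup +-commutativeSemigroup
  using () renaming (interchange to +-interchange)
open import Data.Product using (Σ; ∃; _×_; _,_; proj₁; proj₂)
open import Data.Sum using (_⊎_; inj₁; inj₂; [_,_]′)
open import Data.Vec using (Vec; []; _∷_)
open import Data.Vec.Properties using (∷-injectiveʳ)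
open import Function using (_∘_; id; _⇔_; mk⇔; Equivalence)
open import Relation.Binary.Definitions using (WeaklyDecidable; tri<; tri≈; tri>)
open import Relation.Binary.PropositionalEquality
import Relation.Binary.Reasoning.Setoid
open import Relation.Nullary using (¬_; yes; no; contradiction)

private variable
  n : ℕ
  A : Set

-- Words and their heights

-- The delicate half of the distance formula is that the lower bound Σ_k |h k - h′ k| is attained.
-- Two ideals may be incomparable, and a diagonal on which they differ need not admit a change,
-- since the heights of neighbouring diagonals constrain each other; a single legal step must be
-- found that moves no height past its target. On the side of the series everything stays in ℤ[[x]],
-- where neither 2 nor x is invertible: the square root is built from the Catalan series, relations
-- enter as defects equal to zero, and cancellation rests on ℤ having no zero divisors.

count : Vec Bool n → ℕ
count []          = 0
count (true  ∷ w) = suc (count w)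
count (false ∷ w) = count w

height : Vec Bool n → ℕ → ℕ
height []      _       = 0
height (b ∷ w) zero    = count (b ∷ w)
height (b ∷ w) (suc k) = height w k

gap : Vec Bool n → Vec Bool n → ℕ
gap []      []      = 0
gap (b ∷ w) (c ∷ v) = ∣ count (b ∷ w) - count (c ∷ v) ∣ + gap w v

count≤ : (w : Vec Bool n) → count w ≤ n
count≤ []          = z≤n
count≤ (true  ∷ w) = s≤s (count≤ w)
count≤ (false ∷ w) = m≤n⇒m≤1+n (count≤ w)

count-tail≤ : ∀ b (w : Vec Bool n) → count w ≤ count (b ∷ w)
count-tail≤ true  w = n≤1+n _
count-tail≤ false w = ≤-refl

count≤1+tail : ∀ b (w : Vec Bool n) → count (b ∷ w) ≤ suc (count w)
count≤1+tail true  w = ≤-refl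
count≤1+tail false w = n≤1+n _

count-∷-cong : ∀ b {w v : Vec Bool n} → count w ≡ count v → count (b ∷ w) ≡ count (b ∷ v)
count-∷-cong true  eq = cong suc eq
count-∷-cong false eq = eq

count-∷-injective : ∀ b c (w : Vec Bool n) → count (b ∷ w) ≡ count (c ∷ w) → b ≡ c
count-∷-injective true  true  w eq = refl
count-∷-injective false false w eq = refl
count-∷-injective true  false w eq = contradiction eq 1+n≢n
count-∷-injective false true  w eq = contradiction (sym eq) 1+n≢n

height-zero : (w : Vec Bool n) → height w 0 ≡ count w
height-zero []      = refl
height-zero (_ ∷ _) = refl

height-suc≤ : ∀ (w : Vec Bool n) k → height w (suc k) ≤ height w k
height-suc≤ []      k       = z≤n
height-suc≤ (b ∷ w) zero    = subst (_≤ count (b ∷ w)) (sym (height-zero w)) (count-tail≤ b w)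
height-suc≤ (b ∷ w) (suc k) = height-suc≤ w k

height≤1+suc : ∀ (w : Vec Bool n) k → height w k ≤ suc (height w (suc k))
height≤1+suc []      k       = z≤n
height≤1+suc (b ∷ w) zero    = subst (λ h → count (b ∷ w) ≤ suc h) (sym (height-zero w)) (count≤1+tail b w)
height≤1+suc (b ∷ w) (suc k) = height≤1+suc w k

height-antitone : ∀ (w : Vec Bool n) {k l} → k ≤ l → height w l ≤ height w k
height-antitone w k≤l = go (≤⇒≤′ k≤l)
  where
  go : ∀ {k l} → k ≤′ l → height w l ≤ height w k
  go (≤′-reflexive refl) = ≤-refl
  go (≤′-step {l} k≤l)   = ≤-trans (height-suc≤ w l) (go k≤l)

height-drop : ∀ (w : Vec Bool n) d k → height w k ≤ d + height w (d + k)
height-drop w zero    k = ≤-refl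
height-drop w (suc d) k = begin
  height w k                         ≤⟨ height-drop w d k ⟩
  d + height w (d + k)               ≤⟨ +-monoʳ-≤ d (height≤1+suc w (d + k)) ⟩
  d + suc (height w (suc (d + k)))   ≡⟨ +-suc d _ ⟩
  suc d + height w (suc d + k)       ∎
  where open ≤-Reasoning

<height⇒+< : ∀ (w : Vec Bool n) {i} k → i < height w k → i + k < n
<height⇒+< {suc n} (b ∷ w) {i} zero i<h =
  subst (_< suc n) (sym (+-identityʳ i)) (<-≤-trans i<h (count≤ (b ∷ w)))
<height⇒+< {suc n} (b ∷ w) {i} (suc k) i<h =
  subst (_< suc n) (sym (+-suc i k)) (s≤s (<height⇒+< w k i<h))

-- The order on words, betweenness and single-box steps

infix 4 _≼_ _⋖_

_≼_ : Vec Bool n → Vec Bool n → Set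
w ≼ v = ∀ k → height w k ≤ height v k

≼-antisym : (w v : Vec Bool n) → w ≼ v → v ≼ w → w ≡ v
≼-antisym []      []      _   _   = refl
≼-antisym (b ∷ w) (c ∷ v) w≼v v≼w with ≼-antisym w v (w≼v ∘ suc) (v≼w ∘ suc)
... | refl = cong (_∷ w) (count-∷-injective b c w (≤-antisym (w≼v 0) (v≼w 0)))

gap-refl : (w : Vec Bool n) → gap w w ≡ 0
gap-refl []      = refl
gap-refl (b ∷ w) = cong₂ _+_ (m≡n⇒∣m-n∣≡0 {count (b ∷ w)} refl) (gap-refl w)

gap≡0⇒≡ : (w v : Vec Bool n) → gap w v ≡ 0 → w ≡ v
gap≡0⇒≡ []      []      _  = refl
gap≡0⇒≡ (b ∷ w) (c ∷ v) eq
  with gap≡0⇒≡ w v (m+n≡0⇒n≡0 ∣ count (b ∷ w) - count (c ∷ v) ∣ eq)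
... | refl = cong (_∷ w) (count-∷-injective b c w
               (∣m-n∣≡0⇒m≡n (m+n≡0⇒m≡0 ∣ count (b ∷ w) - count (c ∷ w) ∣ eq)))

gap-comm : (w v : Vec Bool n) → gap w v ≡ gap v w
gap-comm []      []      = refl
gap-comm (b ∷ w) (c ∷ v) = cong₂ _+_ (∣-∣-comm (count (b ∷ w)) (count (c ∷ v))) (gap-comm w v)

gap-triangle : (w u v : Vec Bool n) → gap w v ≤ gap w u + gap u v
gap-triangle []      []      []      = z≤n
gap-triangle (a ∷ w) (b ∷ u) (c ∷ v) = begin
  ∣ x - z ∣ + gap w v                           ≤⟨ +-mono-≤ (∣-∣-triangle x y z) (gap-triangle w u v) ⟩
  ∣ x - y ∣ + ∣ y - z ∣ + (gap w u + gap u v)   ≡⟨ +-interchange ∣ x - y ∣ ∣ y - z ∣ (gap w u) (gap u v) ⟩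
  ∣ x - y ∣ + gap w u + (∣ y - z ∣ + gap u v)   ∎
  where
  open ≤-Reasoning
  x = count (a ∷ w)
  y = count (b ∷ u)
  z = count (c ∷ v)

-- Both directions are allowed because a geodesic between incomparable ideals rises on some
-- diagonals and falls on others.
Between : ℕ → ℕ → ℕ → Set
Between x y z = (x ≤ y × y ≤ z) ⊎ (z ≤ y × y ≤ x)

between-refl : ∀ x z → Between x x z
between-refl x z with ≤-total x z
... | inj₁ x≤z = inj₁ (≤-refl , x≤z)
... | inj₂ z≤x = inj₂ (z≤x , ≤-refl)

between-≡ : ∀ {x y} z → x ≡ y → Between x y z
between-≡ {x} z refl = between-refl x z

∣-∣-additive : ∀ {x y z} → Between x y z → ∣ x - y ∣ + ∣ y - z ∣ ≡ ∣ x - z ∣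
∣-∣-additive {x} {y} {z} (inj₁ (x≤y , y≤z)) = increasing x≤y y≤z
  where
  increasing : ∀ {x y z} → x ≤ y → y ≤ z → ∣ x - y ∣ + ∣ y - z ∣ ≡ ∣ x - z ∣
  increasing {zero}  {y} z≤n       y≤z       = trans (cong (λ z → y + z) (m≤n⇒∣m-n∣≡n∸m y≤z)) (m+[n∸m]≡n y≤z)
  increasing         (s≤s x≤y) (s≤s y≤z) = increasing x≤y y≤z
∣-∣-additive {x} {y} {z} (inj₂ (z≤y , y≤x)) = begin
  ∣ x - y ∣ + ∣ y - z ∣  ≡⟨ +-comm ∣ x - y ∣ _ ⟩
  ∣ y - z ∣ + ∣ x - y ∣  ≡⟨ cong₂ _+_ (∣-∣-comm y z) (∣-∣-comm x y) ⟩
  ∣ z - y ∣ + ∣ y - x ∣  ≡⟨ ∣-∣-additive {z} {y} {x} (inj₁ (z≤y , y≤x)) ⟩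
  ∣ z - x ∣              ≡⟨ ∣-∣-comm z x ⟩
  ∣ x - z ∣              ∎
  where open ≡-Reasoning

gap-additive : (w u v : Vec Bool n) → (∀ k → Between (height w k) (height u k) (height v k)) →
               gap w u + gap u v ≡ gap w v
gap-additive []      []      []      _   = refl
gap-additive (a ∷ w) (b ∷ u) (c ∷ v) btw = trans
  (+-interchange ∣ count (a ∷ w) - count (b ∷ u) ∣ (gap w u) ∣ count (b ∷ u) - count (c ∷ v) ∣ (gap u v))
  (cong₂ _+_ (∣-∣-additive (btw 0)) (gap-additive w u v (btw ∘ suc)))

-- Adding one box: exactly one height grows, by one.
data _⋖_ : Vec Bool n → Vec Bool n → Set where
  raise : {w : Vec Bool n} → false ∷ w ⋖ true ∷ w
  slide : {w : Vec Bool n} → true ∷ false ∷ w ⋖ false ∷ true ∷ w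
  keep  : ∀ b {w v : Vec Bool n} → w ⋖ v → count w ≡ count v → b ∷ w ⋖ b ∷ v

⋖⇒≼ : {w v : Vec Bool n} → w ⋖ v → w ≼ v
⋖⇒≼ raise            zero          = n≤1+n _
⋖⇒≼ raise            (suc k)       = ≤-refl
⋖⇒≼ slide            zero          = ≤-refl
⋖⇒≼ slide            (suc zero)    = n≤1+n _
⋖⇒≼ slide            (suc (suc k)) = ≤-refl
⋖⇒≼ (keep b w⋖v eq)  zero          = ≤-reflexive (count-∷-cong b eq)
⋖⇒≼ (keep b w⋖v eq)  (suc k)       = ⋖⇒≼ w⋖v k

⋖⇒gap≡1 : {w v : Vec Bool n} → w ⋖ v → gap w v ≡ 1
⋖⇒gap≡1 (raise {w = w}) =
  cong₂ _+_ (trans (m≤n⇒∣m-n∣≡n∸m (n≤1+n (count w))) (m+n∸n≡m 1 (count w))) (gap-refl w)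
⋖⇒gap≡1 (slide {w = w}) =
  cong₂ _+_ (m≡n⇒∣m-n∣≡0 {count w} refl) (⋖⇒gap≡1 (raise {w = w}))
⋖⇒gap≡1 (keep b w⋖v eq) = cong₂ _+_ (m≡n⇒∣m-n∣≡0 (count-∷-cong b eq)) (⋖⇒gap≡1 w⋖v)

Towards : Vec Bool n → Vec Bool n → Set
Towards w v = ∃ λ u → (w ⋖ u ⊎ u ⋖ w) × (∀ k → Between (height w k) (height u k) (height v k))

-- If the tails agree, the first letters differ and switching one is a step. Otherwise a step of the
-- tail is extended. It can be kept under the same first letter unless it changes the weight of the
-- tail, which only `raise` does; then the first letter must compensate.
step-towards : (w v : Vec Bool n) → gap w v ≢ 0 → Towards w v
step-towards []      []      gap≢0 = contradiction refl gap≢0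
step-towards (b ∷ w) (c ∷ v) gap≢0 with gap w v ≟ 0
step-towards (b ∷ w) (c ∷ v) gap≢0 | yes gap≡0 with gap≡0⇒≡ w v gap≡0
step-towards (false ∷ w) (false ∷ v) gap≢0 | yes _ | refl = contradiction (gap-refl (false ∷ w)) gap≢0
step-towards (true ∷ w)  (true ∷ v)  gap≢0 | yes _ | refl = contradiction (gap-refl (true ∷ w)) gap≢0
step-towards (false ∷ w) (true ∷ v)  gap≢0 | yes _ | refl = true ∷ w , inj₁ raise , λ where
  zero    → inj₁ (n≤1+n _ , ≤-refl)
  (suc k) → between-refl (height w k) (height v k)
step-towards (true ∷ w)  (false ∷ v) gap≢0 | yes _ | refl = false ∷ w , inj₂ raise , λ where
  zero    → inj₂ (≤-refl , n≤1+n _)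
  (suc k) → between-refl (height w k) (height v k)
step-towards (b ∷ w) (c ∷ v) gap≢0 | no tails≢0 = extend b w v (step-towards w v tails≢0)
  where
  extend : ∀ {n} b (w v : Vec Bool n) → Towards w v → Towards (b ∷ w) (c ∷ v)
  extend b w v (u , w⋖⋗u , btw) with count w ≟ count u
  ... | yes eq = b ∷ u , [ (λ r → inj₁ (keep b r eq)) , (λ r → inj₂ (keep b r (sym eq))) ]′ w⋖⋗u , λ where
    zero    → between-≡ (count (c ∷ v)) (count-∷-cong b eq)
    (suc k) → btw k
  extend b w v (u , inj₁ (keep a r eq) , btw)            | no ≢ = contradiction (count-∷-cong a eq) ≢
  extend b w v (u , inj₂ (keep a r eq) , btw)            | no ≢ = contradiction (count-∷-cong a (sym eq)) ≢
  extend b w v (u , inj₁ slide , btw)                    | no ≢ = contradiction refl ≢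
  extend b w v (u , inj₂ slide , btw)                    | no ≢ = contradiction refl ≢
  -- Swapping the two leading letters makes the same change on the tail and leaves the head height
  -- fixed.
  extend true w v (true ∷ u , inj₁ raise , btw)          | no ≢ = false ∷ true ∷ u , inj₁ slide , λ where
    zero    → between-refl (suc (count u)) (count (c ∷ v))
    (suc k) → btw k
  -- No swap is possible here, and keeping the letter would raise two heights at once. The box goes
  -- on the head diagonal instead; there is room for it because the height of `v` one diagonal
  -- further already exceeds that of `w`. The last case is the mirror image for a removal.
  extend false w (d ∷ v) (true ∷ u , inj₁ raise , btw)   | no ≢ = true ∷ false ∷ u , inj₁ raise , λ where
    zero    → inj₁ (n≤1+n _ , ≤-trans above (count-tail≤ c (d ∷ v)))
    (suc k) → between-refl (height w k) (height (d ∷ v) k)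
   where
    above : suc (count u) ≤ count (d ∷ v)
    above = [ proj₂ , (λ p → contradiction (proj₂ p) (<-irrefl refl)) ]′ (btw 0)
  extend false w v (false ∷ u , inj₂ raise , btw)        | no ≢ = true ∷ false ∷ u , inj₂ slide , λ where
    zero    → between-refl (suc (count u)) (count (c ∷ v))
    (suc k) → btw k
  extend true w (d ∷ v) (false ∷ u , inj₂ raise , btw)   | no ≢ = false ∷ true ∷ u , inj₂ raise , λ where
    zero    → inj₂ (≤-trans (count≤1+tail c (d ∷ v)) (s≤s below) , n≤1+n _)
    (suc k) → between-refl (height w k) (height (d ∷ v) k)
   where
    below : count (d ∷ v) ≤ count u
    below = [ (λ p → contradiction (proj₁ p) (<-irrefl refl)) , proj₁ ]′ (btw 0)

-- Order ideals of the staircase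

T-∧⁻ : ∀ a {b} → T (a ∧ b) → T a × T b
T-∧⁻ a = Equivalence.to (T-∧ {a})

T-∧⁺ : ∀ {a b} → T a → T b → T (a ∧ b)
T-∧⁺ p q = Equivalence.from T-∧ (p , q)

T-∨⁻ : ∀ a {b} → T (a ∨ b) → T a ⊎ T b
T-∨⁻ a = Equivalence.to (T-∨ {a})

T-not⁻ : ∀ a → T (not a) → ¬ T a
T-not⁻ false _ ()

T-not⁺ : ∀ a → ¬ T a → T (not a)
T-not⁺ false _  = _
T-not⁺ true  ¬t = ¬t _

T⇔⇒≡ : ∀ a b → (T a → T b) → (T b → T a) → a ≡ b
T⇔⇒≡ false false _ _ = refl
T⇔⇒≡ true  true  _ _ = refl
T⇔⇒≡ false true  _ g = ⊥-elim (g _)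
T⇔⇒≡ true  false f _ = ⊥-elim (f _)

-- Filters, sublists and Boolean membership

filterB≡filterᵇ : ∀ (P : A → Bool) xs → filterB P xs ≡ filterᵇ P xs
filterB≡filterᵇ P []       = refl
filterB≡filterᵇ P (x ∷ xs) with P x
... | true  = cong (x ∷_) (filterB≡filterᵇ P xs)
... | false = filterB≡filterᵇ P xs

∈-filterB⁺ : ∀ (P : A → Bool) {x xs} → x ∈ xs → T (P x) → x ∈ filterB P xs
∈-filterB⁺ P {x} {xs} x∈xs Px =
  subst (x ∈_) (sym (filterB≡filterᵇ P xs)) (∈-filter⁺ (T? ∘ P) x∈xs Px)

∈-filterB⁻ : ∀ (P : A → Bool) {x xs} → x ∈ filterB P xs → x ∈ xs × T (P x)
∈-filterB⁻ P {x} {xs} x∈ = ∈-filter⁻ (T? ∘ P) (subst (x ∈_) (filterB≡filterᵇ P xs) x∈)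

filterB-unique : ∀ (P : A → Bool) {xs} → Unique xs → Unique (filterB P xs)
filterB-unique P {xs} u = subst Unique (sym (filterB≡filterᵇ P xs)) (Unique.filter⁺ (T? ∘ P) u)

filterB-cong : ∀ {P Q : A → Bool} xs → (∀ {x} → x ∈ xs → P x ≡ Q x) → filterB P xs ≡ filterB Q xs
filterB-cong []       P≗Q = refl
filterB-cong {Q = Q} (x ∷ xs) P≗Q rewrite P≗Q (here refl) with Q x
... | true  = cong (x ∷_) (filterB-cong xs (P≗Q ∘ there))
... | false = filterB-cong xs (P≗Q ∘ there)

filterB∈subsets : ∀ (P : A → Bool) xs → filterB P xs ∈ subsets xs
filterB∈subsets P []       = here refl
filterB∈subsets P (x ∷ xs) with P x
... | true  = ∈-++⁺ˡ (∈-map⁺ (x ∷_) (filterB∈subsets P xs))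
... | false = ∈-++⁺ʳ (map (x ∷_) (subsets xs)) (filterB∈subsets P xs)

∈-subset : ∀ {xs S} {x : A} → S ∈ subsets xs → x ∈ S → x ∈ xs
∈-subset {xs = []}     (here refl) ()
∈-subset {xs = y ∷ xs} S∈ x∈S with ∈-++⁻ (map (y ∷_) (subsets xs)) S∈
... | inj₂ S∈xs = there (∈-subset S∈xs x∈S)
... | inj₁ S∈y∷ with ∈-map⁻ (y ∷_) S∈y∷
...   | S′ , S′∈ , refl with x∈S
...     | here refl  = here refl
...     | there x∈S′ = there (∈-subset S′∈ x∈S′)

subsets-unique : ∀ {xs : List A} → Unique xs → Unique (subsets xs)
subsets-unique {xs = []}     _ = [] ∷ []
subsets-unique {xs = x ∷ xs} u@(_ ∷ u′) =
  Unique.++⁺ (Unique.map⁺ (λ { refl → refl }) (subsets-unique u′)) (subsets-unique u′)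
    λ { (S∈x∷ , S∈xs) → disjoint S∈x∷ S∈xs }
  where
  disjoint : ∀ {S} → S ∈ map (x ∷_) (subsets xs) → S ∈ subsets xs → ⊥
  disjoint S∈x∷ S∈xs with ∈-map⁻ (x ∷_) S∈x∷
  ... | S′ , _ , refl = Unique.Unique[x∷xs]⇒x∉xs u (∈-subset S∈xs (here refl))

eqE⁻ : ∀ x y → T (eqE x y) → x ≡ y
eqE⁻ (a , b) (c , d) t with T-∧⁻ (a ≡ᵇ c) t
... | p , q = cong₂ _,_ (≡ᵇ⇒≡ a c p) (≡ᵇ⇒≡ b d q)

eqE-refl : ∀ x → T (eqE x x)
eqE-refl (a , b) = T-∧⁺ (≡⇒≡ᵇ a a refl) (≡⇒≡ᵇ b b refl)

memE⁺ : ∀ {x S} → x ∈ S → T (memE x S)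
memE⁺ {x} x∈S = any⁺ (eqE x) (Any.map (λ { refl → eqE-refl x }) x∈S)

memE⁻ : ∀ x S → T (memE x S) → x ∈ S
memE⁻ x S t = Any.map (eqE⁻ x _) (any⁻ (eqE x) S t)

subE⁺ : ∀ {S U} → (∀ {x} → x ∈ S → x ∈ U) → T (subE S U)
subE⁺ {S} {U} S⊆U = All.all⁻ (λ x → memE x U) (All.tabulate (memE⁺ ∘ S⊆U))

subE⁻ : ∀ S U → T (subE S U) → ∀ {x} → x ∈ S → x ∈ U
subE⁻ S U t x∈S = memE⁻ _ U (All.lookup (All.all⁺ (λ x → memE x U) S t) x∈S)

-- A sublist of a duplicate-free list is determined by its members. This turns agreement of
-- membership into equality of lists, so that ideals can be identified with words on the nose.
subset≡filterB : ∀ {xs S} → Unique xs → S ∈ subsets xs → S ≡ filterB (λ x → memE x S) xs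
subset≡filterB {[]}     _          (here refl) = refl
subset≡filterB {x ∷ xs} {S} u@(_ ∷ u′) S∈ with ∈-++⁻ (map (x ∷_) (subsets xs)) S∈
... | inj₂ S∈xs with memE x S in eq
...   | true  = contradiction (∈-subset S∈xs (memE⁻ x S (subst T (sym eq) _))) (Unique.Unique[x∷xs]⇒x∉xs u)
...   | false = subset≡filterB u′ S∈xs
subset≡filterB {x ∷ xs} {S} u@(_ ∷ u′) S∈ | inj₁ S∈x∷ with ∈-map⁻ (x ∷_) S∈x∷
... | S′ , S′∈ , refl with memE x (x ∷ S′) in eq
...   | false = ⊥-elim (subst T eq (memE⁺ {x} {x ∷ S′} (here refl)))
...   | true  = cong (x ∷_) (trans (subset≡filterB u′ S′∈) (filterB-cong xs λ {y} y∈xs →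
    T⇔⇒≡ (memE y S′) (memE y (x ∷ S′)) (memE⁺ ∘ there ∘ memE⁻ y S′)
      (λ t → memE⁺ (tail-member y∈xs (memE⁻ y (x ∷ S′) t)))))
  where
  tail-member : ∀ {y} → y ∈ xs → y ∈ x ∷ S′ → y ∈ S′
  tail-member y∈xs (here refl)  = contradiction y∈xs (Unique.Unique[x∷xs]⇒x∉xs u)
  tail-member y∈xs (there y∈S′) = y∈S′

-- The staircase and the correspondence between words and ideals

∈-staircase⁺ : ∀ {n i j} → i ≤ j → j < n → (i , j) ∈ staircase n
∈-staircase⁺ {j = j} i≤j j<n = ∈-concatMap⁺ (λ j → map (_, j) (upTo (suc j)))
  (lose (∈-upTo⁺ j<n) (∈-map⁺ (_, j) (∈-upTo⁺ (s≤s i≤j))))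

∈-staircase⁻ : ∀ n {i j} → (i , j) ∈ staircase n → i ≤ j × j < n
∈-staircase⁻ n x∈ with find (∈-concatMap⁻ (λ j → map (_, j) (upTo (suc j))) {xs = upTo n} x∈)
... | j′ , j′∈ , x∈col with ∈-map⁻ (_, j′) x∈col
...   | i′ , i′∈ , refl = s≤s⁻¹ (∈-upTo⁻ i′∈) , ∈-upTo⁻ j′∈

staircase-unique : ∀ n → Unique (staircase n)
staircase-unique n = Unique.concat⁺
  (All.map⁺ (All.tabulate λ _ → Unique.map⁺ (λ { refl → refl }) (Unique.upTo⁺ _)))
  (AllPairs.map⁺ (AllPairs.map disjoint (Unique.upTo⁺ n)))
  where
  disjoint : ∀ {j k} → j ≢ k → ∀ {x} →
    ¬ (x ∈ map (_, j) (upTo (suc j)) × x ∈ map (_, k) (upTo (suc k)))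
  disjoint {j} {k} j≢k (p , q) with ∈-map⁻ (_, j) p | ∈-map⁻ (_, k) q
  ... | _ , _ , refl | _ , _ , refl = j≢k refl

-- The boxes of an ideal on a diagonal j ∸ i = k form an initial segment, of length height w k.
inside : Vec Bool n → Elt → Bool
inside w (i , j) = i <ᵇ height w (j ∸ i)

ideal : Vec Bool n → List Elt
ideal {n} w = filterB (inside w) (staircase n)

∈-ideal⁺ : ∀ (w : Vec Bool n) i k → i < height w k → (i , i + k) ∈ ideal w
∈-ideal⁺ w i k i<h = ∈-filterB⁺ (inside w) (∈-staircase⁺ (m≤m+n i k) (<height⇒+< w k i<h))
  (<⇒<ᵇ (subst (λ d → i < height w d) (sym (m+n∸m≡n i k)) i<h))

∈-ideal⁻ : ∀ (w : Vec Bool n) i j → (i , j) ∈ ideal w → (i ≤ j × j < n) × i < height w (j ∸ i)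
∈-ideal⁻ {n} w i j x∈ with ∈-filterB⁻ (inside w) {xs = staircase n} x∈
... | x∈st , t = ∈-staircase⁻ n x∈st , <ᵇ⇒< i _ t

subE-ideal⁺ : (w v : Vec Bool n) → w ≼ v → T (subE (ideal w) (ideal v))
subE-ideal⁺ w v w≼v = subE⁺ λ { {i , j} x∈ → member i j (∈-ideal⁻ w i j x∈) }
  where
  member : ∀ i j → (i ≤ j × j < _) × i < height w (j ∸ i) → (i , j) ∈ ideal v
  member i j ((i≤j , _) , i<h) = subst (λ j → (i , j) ∈ ideal v) (m+[n∸m]≡n i≤j)
    (∈-ideal⁺ v i (j ∸ i) (<-≤-trans i<h (w≼v (j ∸ i))))

subE-ideal⁻ : (w v : Vec Bool n) → T (subE (ideal w) (ideal v)) → w ≼ v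
subE-ideal⁻ w v t k = ≮⇒≥ λ v<w →
  let i = height v k
      x∈ = subE⁻ (ideal w) (ideal v) t (∈-ideal⁺ w i k v<w)
  in <-irrefl refl (subst (λ d → i < height v d) (m+n∸m≡n i k) (proj₂ (∈-ideal⁻ v i (i + k) x∈)))

ideal-injective : {w v : Vec Bool n} → ideal w ≡ ideal v → w ≡ v
ideal-injective {w = w} {v} eq = ≼-antisym w v
  (subE-ideal⁻ w v (subst (λ S → T (subE (ideal w) S)) eq (subE-ideal⁺ w w λ _ → ≤-refl)))
  (subE-ideal⁻ v w (subst (λ S → T (subE (ideal v) S)) (sym eq) (subE-ideal⁺ v v λ _ → ≤-refl)))

DownClosed : ℕ → List Elt → Set
DownClosed n S = ∀ {i j a b} → (i , j) ∈ S → a ≤ b → b < n → a ≤ i → b ≤ j → (a , b) ∈ S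

isIdeal⁺ : ∀ n S → DownClosed n S → T (isIdeal n S)
isIdeal⁺ n S closed = All.all⁻ _ (All.tabulate λ {x} x∈S → All.all⁻ _ (All.tabulate λ {y} y∈ → below x y x∈S y∈))
  where
  below : ∀ x y → x ∈ S → y ∈ staircase n → T (not (leqE y x) ∨ memE y S)
  below (i , j) (a , b) x∈S y∈ with leqE (a , b) (i , j) in eq
  ... | false = _
  ... | true with T-∧⁻ (a ≤ᵇ i) (subst T (sym eq) _) | ∈-staircase⁻ n y∈
  ...   | p , q | a≤b , b<n = memE⁺ (closed x∈S a≤b b<n (≤ᵇ⇒≤ a i p) (≤ᵇ⇒≤ b j q))

isIdeal⁻ : ∀ n S → T (isIdeal n S) → DownClosed n S
isIdeal⁻ n S t {i} {j} {a} {b} x∈S a≤b b<n a≤i b≤j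
  with T-∨⁻ (not (leqE (a , b) (i , j)))
         (All.lookup (All.all⁺ _ (staircase n) (All.lookup (All.all⁺ _ S t) x∈S)) (∈-staircase⁺ a≤b b<n))
... | inj₁ ¬leq = contradiction (T-∧⁺ (≤⇒≤ᵇ a≤i) (≤⇒≤ᵇ b≤j)) (T-not⁻ (leqE (a , b) (i , j)) ¬leq)
... | inj₂ y∈S  = memE⁻ (a , b) S y∈S

-- Heights decrease along diagonals, so it is enough to treat the box `(a , j)`. Its diagonal is
-- `i ∸ a` further out than that of `(i , j)`, and each diagonal costs at most one unit of height,
-- exactly what is gained by lowering `i` to `a`.
ideal-downClosed : (w : Vec Bool n) → DownClosed n (ideal w)
ideal-downClosed {n} w {i} {j} {a} {b} x∈ a≤b b<n a≤i b≤j with ∈-ideal⁻ w i j x∈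
... | (i≤j , _) , i<h = subst (λ b → (a , b) ∈ ideal w) (m+[n∸m]≡n a≤b)
        (∈-ideal⁺ w a (b ∸ a) (<-≤-trans a<h (height-antitone w (∸-monoˡ-≤ a b≤j))))
  where
  open ≤-Reasoning
  d = i ∸ a

  diagonals : d + (j ∸ i) ≡ j ∸ a
  diagonals = trans (+-comm d (j ∸ i))
    (trans (sym (+-∸-assoc (j ∸ i) a≤i)) (cong (_∸ a) (m∸n+n≡m i≤j)))

  a<h : a < height w (j ∸ a)
  a<h = +-cancelˡ-< d a _ (begin-strict
    d + a                         ≡⟨ m∸n+n≡m a≤i ⟩
    i                             <⟨ i<h ⟩
    height w (j ∸ i)              ≤⟨ height-drop w d (j ∸ i) ⟩
    d + height w (d + (j ∸ i))    ≡⟨ cong (λ k → d + height w k) diagonals ⟩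
    d + height w (j ∸ a)          ∎)

-- The first letter of the word is R at the first box of diagonal 0 that the other diagonals leave
-- undetermined.
profile : ∀ n (R : ℕ → ℕ → Bool) →
  (∀ i k → i + suc k < n → T (R i (suc k)) → T (R i k)) →
  (∀ i k → i + suc k < n → T (R (suc i) k) → T (R i (suc k))) →
  ∃ λ (w : Vec Bool n) → ∀ i k → i + k < n → T (R i k) ⇔ i < height w k
profile zero    R left up = [] , λ _ _ ()
profile (suc n) R left up with profile n (λ i k → R i (suc k))
    (λ i k lt → left i (suc k) (subst (_< suc n) (sym (+-suc i (suc k))) (s≤s lt)))
    (λ i k lt → up i (suc k) (subst (_< suc n) (sym (+-suc i (suc k))) (s≤s lt)))
... | w , w-profile = R c 0 ∷ w , λ where
    i zero    lt → diagonal i (subst (_< suc n) (+-identityʳ i) lt)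
    i (suc k) lt → w-profile i k (s≤s⁻¹ (subst (_< suc n) (+-suc i k) lt))
  where
  -- The number of boxes on diagonal 1. On diagonal 0, `left` forces in the boxes with index below
  -- `c` and `up` forces out those with index above `c`; only index `c` itself is free.
  c = count w

  next : ∀ i → i < n → T (R i 1) ⇔ i < c
  next i lt = subst (λ h → T (R i 1) ⇔ i < h) (height-zero w)
    (w-profile i 0 (subst (_< n) (sym (+-identityʳ i)) lt))

  +1< : ∀ {i} → i < n → i + 1 < suc n
  +1< {i} lt = subst (_< suc n) (+-comm 1 i) (s≤s lt)

  diagonal : ∀ i → i < suc n → T (R i 0) ⇔ i < count (R c 0 ∷ w)
  diagonal i lt with <-cmp i c
  diagonal i lt | tri< i<c _ _ = mk⇔
    (λ _ → <-≤-trans i<c (count-tail≤ (R c 0) w))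
    (λ _ → left i 0 (+1< i<n) (Equivalence.from (next i i<n) i<c))
    where
    i<n : i < n
    i<n = <-≤-trans i<c (count≤ w)
  diagonal i lt | tri≈ _ refl _ with R c 0
  ... | true  = mk⇔ (λ _ → ≤-refl) _
  ... | false = mk⇔ (λ ()) (<-irrefl refl)
  diagonal (suc i) (s≤s i<n) | tri> _ _ c<1+i = mk⇔
    (λ t → contradiction (Equivalence.to (next i i<n) (up i 0 (+1< i<n) t)) (≤⇒≯ (s≤s⁻¹ c<1+i)))
    (λ lt → contradiction (<-≤-trans lt (count≤1+tail (R c 0) w)) (≤⇒≯ c<1+i))

ideal∈ideals : (w : Vec Bool n) → ideal w ∈ ideals n
ideal∈ideals {n} w = ∈-filterB⁺ (isIdeal n) (filterB∈subsets (inside w) (staircase n))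
  (isIdeal⁺ n (ideal w) (ideal-downClosed w))

ideals-ideal : ∀ n {S} → S ∈ ideals n → ∃ λ (w : Vec Bool n) → S ≡ ideal w
ideals-ideal n {S} S∈ with ∈-filterB⁻ (isIdeal n) {xs = subsets (staircase n)} S∈
... | S∈sub , t with profile n (λ i k → memE (i , i + k) S) left up
  where
  closed : DownClosed n S
  closed = isIdeal⁻ n S t
  left : ∀ i k → i + suc k < n → T (memE (i , i + suc k) S) → T (memE (i , i + k) S)
  left i k lt m = memE⁺ (closed (memE⁻ _ S m) (m≤m+n i k) (≤-<-trans i+k≤ lt) ≤-refl i+k≤)
    where
    i+k≤ : i + k ≤ i + suc k
    i+k≤ = +-monoʳ-≤ i (n≤1+n k)
  up : ∀ i k → i + suc k < n → T (memE (suc i , suc i + k) S) → T (memE (i , i + suc k) S)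
  up i k lt m = memE⁺ (closed (memE⁻ _ S m) (m≤m+n i (suc k)) lt (n≤1+n i) (≤-reflexive (+-suc i k)))
...   | w , w-profile = w , trans (subset≡filterB (staircase-unique n) S∈sub)
          (filterB-cong (staircase n) λ { {i , j} x∈ → agree i j (∈-staircase⁻ n x∈) })
  where
  agree : ∀ i j → i ≤ j × j < n → memE (i , j) S ≡ inside w (i , j)
  agree i j (i≤j , j<n) =
    T⇔⇒≡ (memE (i , j) S) (inside w (i , j))
      (λ t → <⇒<ᵇ (Equivalence.to e (subst (λ j → T (memE (i , j) S)) (sym i+[j∸i]) t)))
      (λ t → subst (λ j → T (memE (i , j) S)) i+[j∸i] (Equivalence.from e (<ᵇ⇒< i _ t)))
    where
    i+[j∸i] : i + (j ∸ i) ≡ j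
    i+[j∸i] = m+[n∸m]≡n i≤j
    e = w-profile i (j ∸ i) (subst (_< n) (sym i+[j∸i]) j<n)

-- The enumeration of ideals by words

words : ∀ n → List (Vec Bool n)
words zero    = [] ∷ []
words (suc n) = map (true ∷_) (words n) ++ map (false ∷_) (words n)

∈-words : (w : Vec Bool n) → w ∈ words n
∈-words []          = here refl
∈-words (true  ∷ w) = ∈-++⁺ˡ (∈-map⁺ (true ∷_) (∈-words w))
∈-words (false ∷ w) = ∈-++⁺ʳ (map (true ∷_) (words _)) (∈-map⁺ (false ∷_) (∈-words w))

words-unique : ∀ n → Unique (words n)
words-unique zero    = [] ∷ []
words-unique (suc n) = Unique.++⁺
  (Unique.map⁺ ∷-injectiveʳ (words-unique n)) (Unique.map⁺ ∷-injectiveʳ (words-unique n)) disjoint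
  where
  disjoint : ∀ {w} → ¬ (w ∈ map (true ∷_) (words n) × w ∈ map (false ∷_) (words n))
  disjoint (p , q) with ∈-map⁻ (true ∷_) p | ∈-map⁻ (false ∷_) q
  ... | _ , _ , refl | _ , _ , ()

length-words : ∀ n → length (words n) ≡ 2 ^ n
length-words zero    = refl
length-words (suc n) = begin
  length (map (true ∷_) (words n) ++ map (false ∷_) (words n))
    ≡⟨ length-++ (map (true ∷_) (words n)) ⟩
  length (map (true ∷_) (words n)) + length (map (false ∷_) (words n))
    ≡⟨ cong₂ _+_ (length-map (true ∷_) (words n)) (length-map (false ∷_) (words n)) ⟩
  length (words n) + length (words n)
    ≡⟨ cong₂ _+_ (length-words n) (length-words n) ⟩
  2 ^ n + 2 ^ n
    ≡⟨ cong (λ x → 2 ^ n + x) (+-identityʳ (2 ^ n)) ⟨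
  2 ^ suc n ∎
  where open ≡-Reasoning

ideals-unique : ∀ n → Unique (ideals n)
ideals-unique n = filterB-unique (isIdeal n) (subsets-unique (staircase-unique n))

-- Two duplicate-free lists with the same members are permutations of each other, and sums and
-- lengths do not see the order.
ideals↭words : ∀ n → ideals n ↭ map ideal (words n)
ideals↭words n = ∼bag⇒↭ (unique∧set⇒bag (ideals-unique n) (Unique.map⁺ ideal-injective (words-unique n))
  (mk⇔ to from))
  where
  to : ∀ {S} → S ∈ ideals n → S ∈ map ideal (words n)
  to S∈ with ideals-ideal n S∈
  ... | w , refl = ∈-map⁺ ideal (∈-words w)

  from : ∀ {S} → S ∈ map ideal (words n) → S ∈ ideals n
  from S∈ with ∈-map⁻ ideal S∈
  ... | w , _ , refl = ideal∈ideals w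

length-ideals : ∀ n → length (ideals n) ≡ 2 ^ n
length-ideals n = trans (↭-length (ideals↭words n)) (trans (length-map ideal (words n)) (length-words n))

-- The Hasse diagram and its distance

eqI⁻ : (w v : Vec Bool n) → T (eqI (ideal w) (ideal v)) → w ≡ v
eqI⁻ w v t with T-∧⁻ (subE (ideal w) (ideal v)) t
... | p , q = ≼-antisym w v (subE-ideal⁻ w v p) (subE-ideal⁻ v w q)

eqI-refl : (w : Vec Bool n) → T (eqI (ideal w) (ideal w))
eqI-refl w = T-∧⁺ w⊆w w⊆w
  where
  w⊆w : T (subE (ideal w) (ideal w))
  w⊆w = subE-ideal⁺ w w λ _ → ≤-refl

properE⁺ : (w v : Vec Bool n) → w ≼ v → w ≢ v → T (properE (ideal w) (ideal v))
properE⁺ w v w≼v w≢v = T-∧⁺ (subE-ideal⁺ w v w≼v)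
  (T-not⁺ (subE (ideal v) (ideal w)) λ t → w≢v (≼-antisym w v w≼v (subE-ideal⁻ v w t)))

properE⁻ : (w v : Vec Bool n) → T (properE (ideal w) (ideal v)) → w ≼ v × gap w v ≢ 0
properE⁻ w v t with T-∧⁻ (subE (ideal w) (ideal v)) t
... | p , ¬q = subE-ideal⁻ w v p , λ gap≡0 → T-not⁻ (subE (ideal v) (ideal w)) ¬q
  (subE-ideal⁺ v w (subst (_≼ w) (gap≡0⇒≡ w v gap≡0) λ _ → ≤-refl))

gap≢0⇒≢ : (w v : Vec Bool n) → gap w v ≢ 0 → w ≢ v
gap≢0⇒≢ w _ gap≢0 refl = gap≢0 (gap-refl w)

gap≡1⇒≢ : (w v : Vec Bool n) → gap w v ≡ 1 → w ≢ v
gap≡1⇒≢ w v gap≡1 = gap≢0⇒≢ w v λ gap≡0 → contradiction (trans (sym gap≡1) gap≡0) λ ()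

gap-chain : (w u v : Vec Bool n) → w ≼ u → u ≼ v → gap w u + gap u v ≡ gap w v
gap-chain w u v w≼u u≼v = gap-additive w u v λ k → inj₁ (w≼u k , u≼v k)

-- The gap is additive along chains, so an ideal strictly in between would split a gap of 1 into two
-- nonzero parts.
covers⁺ : {w v : Vec Bool n} → w ⋖ v → T (covers n (ideal w) (ideal v))
covers⁺ {n} {w} {v} w⋖v = T-∧⁺ (properE⁺ w v (⋖⇒≼ w⋖v) (gap≡1⇒≢ w v (⋖⇒gap≡1 w⋖v)))
  (T-not⁺ (any between? (ideals n)) λ t → none (find (any⁻ between? (ideals n) t)))
  where
  between? : List Elt → Bool
  between? K = properE (ideal w) K ∧ properE K (ideal v)

  1≢m+n : ∀ {k l} → k ≢ 0 → l ≢ 0 → k + l ≢ 1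
  1≢m+n {zero}        k≢0 _   _ = k≢0 refl
  1≢m+n {suc k} {zero} _  l≢0 _ = l≢0 refl
  1≢m+n {suc k} {suc l} _ _   eq = contradiction (trans (sym (+-suc k l)) (suc-injective eq)) λ ()

  none : ¬ (∃ λ K → K ∈ ideals n × T (between? K))
  none (K , K∈ , t) with ideals-ideal n K∈
  ... | u , refl with T-∧⁻ (properE (ideal w) (ideal u)) t
  ...   | w<u , u<v with properE⁻ w u w<u | properE⁻ u v u<v
  ...     | w≼u , wu≢0 | u≼v , uv≢0 = 1≢m+n wu≢0 uv≢0 (trans (gap-chain w u v w≼u u≼v) (⋖⇒gap≡1 w⋖v))

-- Take a step `u` from `w` towards `v`. As `w ≼ v`, it cannot lead down, and `w ⋖ u ≼ v` leaves
-- only `u` equal to `v`, since otherwise `u` would lie strictly between.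
covers⁻ : (w v : Vec Bool n) → T (covers n (ideal w) (ideal v)) → gap w v ≡ 1
covers⁻ {n} w v t with T-∧⁻ (properE (ideal w) (ideal v)) t
... | w<v , nothing-between with properE⁻ w v w<v
...   | w≼v , gap≢0 with step-towards w v gap≢0
...     | u , inj₂ u⋖w , btw = contradiction (≼-antisym u w u≼w w≼u) (gap≡1⇒≢ u w (⋖⇒gap≡1 u⋖w))
  where
  u≼w : u ≼ w
  u≼w = ⋖⇒≼ u⋖w
  w≼u : w ≼ u
  w≼u k = [ proj₁ , (λ p → ≤-trans (w≼v k) (proj₁ p)) ]′ (btw k)
...     | u , inj₁ w⋖u , btw with gap u v ≟ 0
...       | yes uv≡0 = subst (λ v → gap w v ≡ 1) (gap≡0⇒≡ u v uv≡0) (⋖⇒gap≡1 w⋖u)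
...       | no uv≢0 = contradiction
  (any⁺ (λ K → properE (ideal w) K ∧ properE K (ideal v)) (lose (ideal∈ideals u)
    (T-∧⁺ (properE⁺ w u (⋖⇒≼ w⋖u) (gap≡1⇒≢ w u (⋖⇒gap≡1 w⋖u))) (properE⁺ u v u≼v (gap≢0⇒≢ u v uv≢0)))))
  (T-not⁻ (any (λ K → properE (ideal w) K ∧ properE K (ideal v)) (ideals n)) nothing-between)
  where
  u≼v : u ≼ v
  u≼v k = [ proj₂ , (λ p → ≤-trans (proj₂ p) (w≼v k)) ]′ (btw k)

hasseAdj⁻ : (w v : Vec Bool n) → T (hasseAdj n (ideal w) (ideal v)) → gap w v ≡ 1
hasseAdj⁻ {n} w v t with T-∨⁻ (covers n (ideal w) (ideal v)) t
... | inj₁ up   = covers⁻ w v up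
... | inj₂ down = trans (gap-comm w v) (covers⁻ v w down)

hasseAdj⁺ : {w v : Vec Bool n} → w ⋖ v ⊎ v ⋖ w → T (hasseAdj n (ideal w) (ideal v))
hasseAdj⁺ {n} {w} {v} r = Equivalence.from (T-∨ {covers n (ideal w) (ideal v)})
  ([ inj₁ ∘ covers⁺ , inj₂ ∘ covers⁺ ]′ r)

reachable : ∀ n → ℕ → List Elt → List Elt → Bool
reachable n = reach (ideals n) eqI (hasseAdj n)

-- The lower bound on distances: every Hasse edge has gap 1, so the triangle inequality bounds the
-- gap by the length of a walk.
reach⁻ : ∀ k (w v : Vec Bool n) → T (reachable n k (ideal w) (ideal v)) → gap w v ≤ k
reach⁻ zero    w v t with eqI⁻ w v t
... | refl = ≤-reflexive (gap-refl w)
reach⁻ {n} (suc k) w v t with T-∨⁻ (reachable n k (ideal w) (ideal v)) t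
... | inj₁ shorter = m≤n⇒m≤1+n (reach⁻ k w v shorter)
... | inj₂ longer with find (any⁻ _ (ideals n) longer)
...   | K , K∈ , adj∧reach with ideals-ideal n K∈
...     | u , refl with T-∧⁻ (hasseAdj n (ideal w) (ideal u)) adj∧reach
...       | adj , r = ≤-trans (gap-triangle w u v)
              (+-mono-≤ (≤-reflexive (hasseAdj⁻ w u adj)) (reach⁻ k u v r))

-- The upper bound: a step towards `v` lowers the gap by exactly one, because the gap is additive
-- through an intermediate word.
reach⁺ : ∀ k (w v : Vec Bool n) → gap w v ≤ k → T (reachable n k (ideal w) (ideal v))
reach⁺ zero    w v gap≤0 with gap≡0⇒≡ w v (n≤0⇒n≡0 gap≤0)
... | refl = eqI-refl w
reach⁺ {n} (suc k) w v gap≤1+k with gap w v ≟ 0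
... | yes gap≡0 = Equivalence.from (T-∨ {reachable n k (ideal w) (ideal v)})
  (inj₁ (reach⁺ k w v (subst (_≤ k) (sym gap≡0) z≤n)))
... | no gap≢0 with step-towards w v gap≢0
...   | u , w⋖⋗u , btw = Equivalence.from (T-∨ {reachable n k (ideal w) (ideal v)})
  (inj₂ (any⁺ _ (lose (ideal∈ideals u) (T-∧⁺ (hasseAdj⁺ w⋖⋗u) (reach⁺ k u v gap≤k)))))
  where
  gap-wu : gap w u ≡ 1
  gap-wu = [ ⋖⇒gap≡1 , (λ u⋖w → trans (gap-comm w u) (⋖⇒gap≡1 u⋖w)) ]′ w⋖⋗u
  gap≤k : gap u v ≤ k
  gap≤k = s≤s⁻¹ (subst (_≤ suc k)
    (trans (sym (gap-additive w u v btw)) (cong (_+ gap u v) gap-wu)) gap≤1+k)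

n<2^n : ∀ n → n < 2 ^ n
n<2^n zero    = s≤s z≤n
n<2^n (suc n) = begin-strict
  suc n           ≤⟨ n<2^n n ⟩
  2 ^ n           <⟨ m<m+n (2 ^ n) (m^n>0 2 n) ⟩
  2 ^ n + 2 ^ n   ≡⟨ cong (λ x → 2 ^ n + x) (+-identityʳ (2 ^ n)) ⟨
  2 ^ suc n       ∎
  where open ≤-Reasoning

-- A crude bound, chosen because `2 ^ n` is the number of ideals, at which the search in `dist`
-- stops.
gap≤2^n : (w v : Vec Bool n) → gap w v ≤ 2 ^ n
gap≤2^n {zero}  []      []      = z≤n
gap≤2^n {suc n} (b ∷ w) (c ∷ v) = begin
  ∣ count (b ∷ w) - count (c ∷ v) ∣ + gap w v  ≤⟨ +-mono-≤ head≤ (gap≤2^n w v) ⟩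
  2 ^ n + 2 ^ n                                ≡⟨ cong (λ x → 2 ^ n + x) (+-identityʳ (2 ^ n)) ⟨
  2 ^ suc n                                    ∎
  where
  open ≤-Reasoning
  head≤ : ∣ count (b ∷ w) - count (c ∷ v) ∣ ≤ 2 ^ n
  head≤ = ≤-trans (∣m-n∣≤m⊔n (count (b ∷ w)) (count (c ∷ v)))
    (≤-trans (⊔-lub (count≤ (b ∷ w)) (count≤ (c ∷ v))) (n<2^n n))

-- The case `m = N` is included: the search then fails and returns its default, which is again
-- `f N`. The general `f` absorbs the shift of the list in the induction.
firstWith-applyUpTo : ∀ (P : ℕ → Bool) (f : ℕ → ℕ) {m N} → m ≤ N →
  (∀ k → k < m → ¬ T (P (f k))) → T (P (f m)) → firstWith P (f N) (applyUpTo f N) ≡ f m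
firstWith-applyUpTo P f {N = zero}      z≤n _    _ = refl
firstWith-applyUpTo P f {zero}  {suc N} _   _    Pm with P (f 0)
... | true = refl
firstWith-applyUpTo P f {suc m} {suc N} (s≤s m≤N) ¬P Pm with P (f 0) in eq
... | true  = contradiction (subst T (sym eq) _) (¬P 0 (s≤s z≤n))
... | false = firstWith-applyUpTo P (f ∘ suc) m≤N (λ k k<m → ¬P (suc k) (s≤s k<m)) Pm

dist≡gap : (w v : Vec Bool n) → dist (ideals n) eqI (hasseAdj n) (ideal w) (ideal v) ≡ gap w v
dist≡gap {n} w v = firstWith-applyUpTo (λ k → reachable n k (ideal w) (ideal v)) id
  (subst (gap w v ≤_) (sym (length-ideals n)) (gap≤2^n w v))
  (λ k k<gap t → contradiction (reach⁻ k w v t) (<⇒≱ k<gap))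
  (reach⁺ (gap w v) w v ≤-refl)

-- Summation over pairs of words

sumWords : ∀ n → (Vec Bool n → ℕ) → ℕ
sumWords zero    f = f []
sumWords (suc n) f = sumWords n (λ w → f (true ∷ w)) + sumWords n (λ w → f (false ∷ w))

sumWords-cong : ∀ n {f g} → (∀ w → f w ≡ g w) → sumWords n f ≡ sumWords n g
sumWords-cong zero    f≗g = f≗g []
sumWords-cong (suc n) f≗g = cong₂ _+_ (sumWords-cong n (f≗g ∘ (true ∷_))) (sumWords-cong n (f≗g ∘ (false ∷_)))

sumWords-+ : ∀ n f g → sumWords n (λ w → f w + g w) ≡ sumWords n f + sumWords n g
sumWords-+ zero    f g = refl
sumWords-+ (suc n) f g = trans
  (cong₂ _+_ (sumWords-+ n (f ∘ (true ∷_)) (g ∘ (true ∷_))) (sumWords-+ n (f ∘ (false ∷_)) (g ∘ (false ∷_))))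
  (+-interchange (sumWords n (f ∘ (true ∷_))) _ _ _)

sum-words : ∀ n f → sumℕ (map f (words n)) ≡ sumWords n f
sum-words zero    f = +-identityʳ (f [])
sum-words (suc n) f = begin
  sumℕ (map f (map (true ∷_) (words n) ++ map (false ∷_) (words n)))
    ≡⟨ cong sumℕ (map-++ f (map (true ∷_) (words n)) (map (false ∷_) (words n))) ⟩
  sumℕ (map f (map (true ∷_) (words n)) ++ map f (map (false ∷_) (words n)))
    ≡⟨ sum-++ (map f (map (true ∷_) (words n))) _ ⟩
  sumℕ (map f (map (true ∷_) (words n))) + sumℕ (map f (map (false ∷_) (words n)))
    ≡⟨ cong₂ (λ xs ys → sumℕ xs + sumℕ ys) (map-∘ (words n)) (map-∘ (words n)) ⟨
  sumℕ (map (f ∘ (true ∷_)) (words n)) + sumℕ (map (f ∘ (false ∷_)) (words n))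
    ≡⟨ cong₂ _+_ (sum-words n (f ∘ (true ∷_))) (sum-words n (f ∘ (false ∷_))) ⟩
  sumWords (suc n) f ∎
  where open ≡-Reasoning

sum-ideals : ∀ n (f : List Elt → ℕ) → sumℕ (map f (ideals n)) ≡ sumWords n (f ∘ ideal)
sum-ideals n f = begin
  sumℕ (map f (ideals n))             ≡⟨ sum-↭ (↭-map⁺ f (ideals↭words n)) ⟩
  sumℕ (map f (map ideal (words n)))  ≡⟨ cong sumℕ (map-∘ (words n)) ⟨
  sumℕ (map (f ∘ ideal) (words n))    ≡⟨ sum-words n (f ∘ ideal) ⟩
  sumWords n (f ∘ ideal)              ∎
  where open ≡-Reasoning

sumPairs : ∀ n → (Vec Bool n → Vec Bool n → ℕ) → ℕ
sumPairs n F = sumWords n λ w → sumWords n λ v → F w v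

sumPairs-cong : ∀ n {F G} → (∀ w v → F w v ≡ G w v) → sumPairs n F ≡ sumPairs n G
sumPairs-cong n F≗G = sumWords-cong n λ w → sumWords-cong n λ v → F≗G w v

sumPairs-+ : ∀ n F G → sumPairs n (λ w v → F w v + G w v) ≡ sumPairs n F + sumPairs n G
sumPairs-+ n F G = trans (sumWords-cong n λ w → sumWords-+ n (F w) (G w))
  (sumWords-+ n (λ w → sumWords n (F w)) (λ w → sumWords n (G w)))

byHeads : (Vec Bool (suc n) → Vec Bool (suc n) → ℕ) → Vec Bool n → Vec Bool n → ℕ
byHeads F w v = F (true ∷ w) (true ∷ v) + F (true ∷ w) (false ∷ v)
              + (F (false ∷ w) (true ∷ v) + F (false ∷ w) (false ∷ v))

sumPairs-suc : ∀ n F → sumPairs (suc n) F ≡ sumPairs n (byHeads F)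
sumPairs-suc n F = sym (trans
  (sumPairs-+ n (λ w v → F (true ∷ w) (true ∷ v) + F (true ∷ w) (false ∷ v)) _)
  (cong₂ _+_ (split true) (split false)))
  where
  split : ∀ b → sumPairs n (λ w v → F (b ∷ w) (true ∷ v) + F (b ∷ w) (false ∷ v))
              ≡ sumWords n (λ w → sumWords (suc n) (F (b ∷ w)))
  split b = sumWords-cong n λ w → sumWords-+ n (F (b ∷ w) ∘ (true ∷_)) (F (b ∷ w) ∘ (false ∷_))

dQ≡sumPairs : ∀ n → dQ n ≡ sumPairs n gap
dQ≡sumPairs n = trans
  (sum-ideals n λ p → sumℕ (map (dist (ideals n) eqI (hasseAdj n) p) (ideals n)))
  (sumWords-cong n λ w → trans (sum-ideals n (dist (ideals n) eqI (hasseAdj n) (ideal w)))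
    (sumWords-cong n λ v → dist≡gap w v))

-- The reflected walk of weight differences

-- Δ f m is the sum of f ||w′| − |v′|| over the one-letter extensions of words with ||w| − |v|| = m.
Δ : (ℕ → ℕ) → ℕ → ℕ
Δ f zero    = 2 * f 0 + 2 * f 1
Δ f (suc m) = f m + 2 * f (suc m) + f (suc (suc m))

Δ^ : ℕ → (ℕ → ℕ) → ℕ → ℕ
Δ^ zero    f = f
Δ^ (suc n) f = Δ (Δ^ n f)

δ₀ : ℕ → ℕ
δ₀ zero    = 1
δ₀ (suc _) = 0

countDiff : Vec Bool n → Vec Bool n → ℕ
countDiff w v = ∣ count w - count v ∣

-- Two of the four pairs of letters keep the difference of weights, one raises it and one lowers it.
-- At difference 0 the last two both lead to 1, which is the reflection.
Δ-∣-∣ : ∀ f x y → f ∣ suc x - suc y ∣ + f ∣ suc x - y ∣ + (f ∣ x - suc y ∣ + f ∣ x - y ∣) ≡ Δ f ∣ x - y ∣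
Δ-∣-∣ f zero    zero    = lemma (f 0) (f 1)
  where
  lemma : ∀ a b → a + b + (b + a) ≡ 2 * a + 2 * b
  lemma = ℕ-Ring.solve-∀
Δ-∣-∣ f zero    (suc y) = lemma (f y) (f (suc y)) (f (suc (suc y)))
  where
  lemma : ∀ a b c → b + a + (c + b) ≡ a + 2 * b + c
  lemma = ℕ-Ring.solve-∀
Δ-∣-∣ f (suc x) zero    rewrite ∣-∣-identityʳ x = lemma (f x) (f (suc x)) (f (suc (suc x)))
  where
  lemma : ∀ a b c → b + c + (a + b) ≡ a + 2 * b + c
  lemma = ℕ-Ring.solve-∀
Δ-∣-∣ f (suc x) (suc y) = Δ-∣-∣ f x y

-- Splitting off first letters applies the new `Δ` to the test function, hence innermost, whereas
-- `Δ^` adds it outermost.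
Δ^-shift : ∀ k f → Δ^ k (Δ f) ≡ Δ (Δ^ k f)
Δ^-shift zero    f = refl
Δ^-shift (suc k) f = cong Δ (Δ^-shift k f)

sumPairs-countDiff : ∀ n f → sumPairs n (λ w v → f (countDiff w v)) ≡ Δ^ n f 0
sumPairs-countDiff zero    f = refl
sumPairs-countDiff (suc n) f = begin
  sumPairs (suc n) (λ w v → f (countDiff w v))  ≡⟨ sumPairs-suc n (λ w v → f (countDiff w v)) ⟩
  sumPairs n (byHeads λ w v → f (countDiff w v))  ≡⟨ sumPairs-cong n (λ w v → Δ-∣-∣ f (count w) (count v)) ⟩
  sumPairs n (λ w v → Δ f (countDiff w v))      ≡⟨ sumPairs-countDiff n (Δ f) ⟩
  Δ^ n (Δ f) 0                                  ≡⟨ cong (λ g → g 0) (Δ^-shift n f) ⟩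
  Δ^ (suc n) f 0                                ∎
  where open ≡-Reasoning

sumPairs-gap : ∀ n → sumPairs (suc n) gap ≡ 4 * sumPairs n gap + Δ^ (suc n) id 0
sumPairs-gap n = begin
  sumPairs (suc n) gap
    ≡⟨ sumPairs-suc n gap ⟩
  sumPairs n (byHeads gap)
    ≡⟨ sumPairs-cong n (λ w v → lemma (countDiff (true ∷ w) (true ∷ v)) (countDiff (true ∷ w) (false ∷ v))
         (countDiff (false ∷ w) (true ∷ v)) (countDiff (false ∷ w) (false ∷ v)) (gap w v)) ⟩
  sumPairs n (λ w v → (gap w v + gap w v + (gap w v + gap w v)) + byHeads countDiff w v)
    ≡⟨ sumPairs-+ n (λ w v → gap w v + gap w v + (gap w v + gap w v)) (byHeads countDiff) ⟩
  sumPairs n (λ w v → gap w v + gap w v + (gap w v + gap w v)) + sumPairs n (byHeads countDiff)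
    ≡⟨ cong₂ _+_ (sumPairs-+ n (λ w v → gap w v + gap w v) (λ w v → gap w v + gap w v))
         (sym (sumPairs-suc n countDiff)) ⟩
  sumPairs n (λ w v → gap w v + gap w v) + sumPairs n (λ w v → gap w v + gap w v) + sumPairs (suc n) countDiff
    ≡⟨ cong₂ _+_ (cong (λ x → x + x) (sumPairs-+ n gap gap)) (sumPairs-countDiff (suc n) id) ⟩
  sumPairs n gap + sumPairs n gap + (sumPairs n gap + sumPairs n gap) + Δ^ (suc n) id 0
    ≡⟨ cong (_+ Δ^ (suc n) id 0) (quadruple (sumPairs n gap)) ⟩
  4 * sumPairs n gap + Δ^ (suc n) id 0 ∎
  where
  open ≡-Reasoning
  quadruple : ∀ g → g + g + (g + g) ≡ 4 * g
  quadruple = ℕ-Ring.solve-∀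
  lemma : ∀ p q r s g → (p + g) + (q + g) + ((r + g) + (s + g)) ≡ (g + g + (g + g)) + (p + q + (r + s))
  lemma = ℕ-Ring.solve-∀

Δ-cong : ∀ {f g} → (∀ m → f m ≡ g m) → ∀ m → Δ f m ≡ Δ g m
Δ-cong f≗g zero    = cong₂ (λ x y → 2 * x + 2 * y) (f≗g 0) (f≗g 1)
Δ-cong f≗g (suc m) = cong₂ _+_
  (cong₂ (λ x y → x + 2 * y) (f≗g m) (f≗g (suc m))) (f≗g (suc (suc m)))

Δ-linear : ∀ a b f g m → Δ (λ i → a * f i + b * g i) m ≡ a * Δ f m + b * Δ g m
Δ-linear a b f g zero = lemma a b (f 0) (g 0) (f 1) (g 1)
  where
  lemma : ∀ a b x y z w → 2 * (a * x + b * y) + 2 * (a * z + b * w)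
                        ≡ a * (2 * x + 2 * z) + b * (2 * y + 2 * w)
  lemma = ℕ-Ring.solve-∀
Δ-linear a b f g (suc m) =
  lemma a b (f m) (g m) (f (suc m)) (g (suc m)) (f (suc (suc m))) (g (suc (suc m)))
  where
  lemma : ∀ a b x y z w u v →
    (a * x + b * y) + 2 * (a * z + b * w) + (a * u + b * v)
    ≡ a * (x + 2 * z + u) + b * (y + 2 * w + v)
  lemma = ℕ-Ring.solve-∀

-- The identity is an eigenfunction of `Δ` with eigenvalue 4 except at the reflecting point, where
-- `Δ id 0` is 2 instead of 0. So `Δ id` is `4 id + 2 δ₀`, and linearity carries this through the
-- iterates.
Δ^-id-suc : ∀ k m → Δ^ (suc k) id m ≡ 4 * Δ^ k id m + 2 * Δ^ k δ₀ m
Δ^-id-suc zero    zero    = refl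
Δ^-id-suc zero    (suc m) = lemma m
  where
  lemma : ∀ m → m + 2 * (1 + m) + (2 + m) ≡ 4 * (1 + m) + 0
  lemma = ℕ-Ring.solve-∀
Δ^-id-suc (suc k) m = trans (Δ-cong (Δ^-id-suc k) m) (Δ-linear 4 2 (Δ^ k id) (Δ^ k δ₀) m)

-- Formal power series

infix 4 _≋_

-- A record keeps both series visible in the type, so that they can be inferred by unification.
record _≋_ (f g : PS) : Set where
  constructor coeffwise
  field at : ∀ k → f k ≡ g k

open _≋_

tail : PS → PS
tail f k = f (suc k)

neg : PS → PS
neg f k = ℤ.- f k

⊛-zero : ∀ f g → (f ⊛ g) 0 ≡ f 0 ℤ.* g 0
⊛-zero f g = ℤₚ.+-identityʳ _

-- Together with its mirror image `⊛-sucʳ`, this replaces the sum over indices by a recursion on the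
-- degree, from which the ring laws follow by induction.
⊛-suc : ∀ f g k → (f ⊛ g) (suc k) ≡ f 0 ℤ.* g (suc k) ℤ.+ (tail f ⊛ g) k
⊛-suc f g k = trans
  (cong sumℤ (map-upTo (λ i → f i ℤ.* g (suc k ∸ i)) (suc (suc k))))
  (cong (λ l → f 0 ℤ.* g (suc k) ℤ.+ sumℤ l)
    (sym (map-upTo (λ i → f (suc i) ℤ.* g (k ∸ i)) (suc k))))

-- The bounded form serves where factors agree only up to degree `k`: the Catalan approximants and
-- the inductions on coefficients.
⊛-cong-≤ : ∀ {f f′ g g′} k → (∀ i → i ≤ k → f i ≡ f′ i) → (∀ i → i ≤ k → g i ≡ g′ i) →
           (f ⊛ g) k ≡ (f′ ⊛ g′) k
⊛-cong-≤ {f} {f′} {g} {g′} zero ff gg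
  rewrite ⊛-zero f g | ⊛-zero f′ g′ = cong₂ ℤ._*_ (ff 0 z≤n) (gg 0 z≤n)
⊛-cong-≤ {f} {f′} {g} {g′} (suc k) ff gg
  rewrite ⊛-suc f g k | ⊛-suc f′ g′ k =
  cong₂ ℤ._+_ (cong₂ ℤ._*_ (ff 0 z≤n) (gg (suc k) ≤-refl))
    (⊛-cong-≤ k (λ i i≤k → ff (suc i) (s≤s i≤k)) (λ i i≤k → gg i (m≤n⇒m≤1+n i≤k)))

⊛-cong : ∀ {f f′ g g′} → f ≋ f′ → g ≋ g′ → f ⊛ g ≋ f′ ⊛ g′
⊛-cong p q .at k = ⊛-cong-≤ k (λ i _ → at p i) (λ i _ → at q i)

⊛-sucʳ : ∀ f g k → (f ⊛ g) (suc k) ≡ (f ⊛ tail g) k ℤ.+ f (suc k) ℤ.* g 0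
⊛-sucʳ f g zero
  rewrite ⊛-suc f g 0 | ⊛-zero (tail f) g | ⊛-zero f (tail g) = refl
⊛-sucʳ f g (suc k)
  rewrite ⊛-suc f g (suc k) | ⊛-suc f (tail g) k | ⊛-sucʳ (tail f) g k =
  sym (ℤₚ.+-assoc (f 0 ℤ.* g (suc (suc k))) _ _)

⊛-comm : ∀ f g → f ⊛ g ≋ g ⊛ f
⊛-comm f g .at zero
  rewrite ⊛-zero f g | ⊛-zero g f = ℤₚ.*-comm (f 0) (g 0)
⊛-comm f g .at (suc k)
  rewrite ⊛-suc f g k | ⊛-sucʳ g f k | at (⊛-comm (tail f) g) k | ℤₚ.*-comm (f 0) (g (suc k)) =
  ℤₚ.+-comm _ ((g ⊛ tail f) k)

cst⊛ : ∀ c f k → (cst c ⊛ f) k ≡ c ℤ.* f k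
cst⊛ c f zero = ⊛-zero (cst c) f
cst⊛ c f (suc k)
  rewrite ⊛-suc (cst c) f k = trans (cong (λ x → c ℤ.* f (suc k) ℤ.+ x) (0⊛ f k)) (ℤₚ.+-identityʳ _)
  where
  0⊛ : ∀ f k → ((λ _ → + 0) ⊛ f) k ≡ + 0
  0⊛ f zero    = ⊛-zero (λ _ → + 0) f
  0⊛ f (suc k) rewrite ⊛-suc (λ _ → + 0) f k | 0⊛ f k = ℤₚ.+-identityʳ _

⊛-distribʳ : ∀ h f g → (f ⊕ g) ⊛ h ≋ f ⊛ h ⊕ g ⊛ h
⊛-distribʳ h f g .at zero
  rewrite ⊛-zero (f ⊕ g) h | ⊛-zero f h | ⊛-zero g h = ℤₚ.*-distribʳ-+ (h 0) (f 0) (g 0)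
⊛-distribʳ h f g .at (suc k)
  rewrite ⊛-suc (f ⊕ g) h k | ⊛-suc f h k | ⊛-suc g h k | at (⊛-distribʳ h (tail f) (tail g)) k =
  lemma (f 0) (g 0) (h (suc k)) _ _
  where
  lemma : ∀ a b c d e → (a ℤ.+ b) ℤ.* c ℤ.+ (d ℤ.+ e) ≡ (a ℤ.* c ℤ.+ d) ℤ.+ (b ℤ.* c ℤ.+ e)
  lemma = ℤ-Ring.solve-∀

scale-⊛ : ∀ c f g k → ((λ i → c ℤ.* f i) ⊛ g) k ≡ c ℤ.* (f ⊛ g) k
scale-⊛ c f g zero
  rewrite ⊛-zero (λ i → c ℤ.* f i) g | ⊛-zero f g = ℤₚ.*-assoc c (f 0) (g 0)
scale-⊛ c f g (suc k)
  rewrite ⊛-suc (λ i → c ℤ.* f i) g k | ⊛-suc f g k | scale-⊛ c (tail f) g k =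
  lemma c (f 0) (g (suc k)) _
  where
  lemma : ∀ a b d e → a ℤ.* b ℤ.* d ℤ.+ a ℤ.* e ≡ a ℤ.* (b ℤ.* d ℤ.+ e)
  lemma = ℤ-Ring.solve-∀

⊛-assoc : ∀ f g h → (f ⊛ g) ⊛ h ≋ f ⊛ (g ⊛ h)
⊛-assoc f g h .at zero
  rewrite ⊛-zero (f ⊛ g) h | ⊛-zero f (g ⊛ h) | ⊛-zero f g | ⊛-zero g h =
  ℤₚ.*-assoc (f 0) (g 0) (h 0)
⊛-assoc f g h .at (suc k) = begin
  ((f ⊛ g) ⊛ h) (suc k)
    ≡⟨ ⊛-suc (f ⊛ g) h k ⟩
  (f ⊛ g) 0 ℤ.* h (suc k) ℤ.+ (tail (f ⊛ g) ⊛ h) k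
    ≡⟨ cong₂ ℤ._+_ (cong (ℤ._* h (suc k)) (⊛-zero f g))
         (⊛-cong-≤ {g = h} k (λ i _ → ⊛-suc f g i) (λ _ _ → refl)) ⟩
  f 0 ℤ.* g 0 ℤ.* h (suc k) ℤ.+ (((λ i → f 0 ℤ.* tail g i) ⊕ (tail f ⊛ g)) ⊛ h) k
    ≡⟨ cong (λ x → f 0 ℤ.* g 0 ℤ.* h (suc k) ℤ.+ x)
         (trans (at (⊛-distribʳ h (λ i → f 0 ℤ.* tail g i) (tail f ⊛ g)) k)
           (cong₂ ℤ._+_ (scale-⊛ (f 0) (tail g) h k) (at (⊛-assoc (tail f) g h) k))) ⟩
  f 0 ℤ.* g 0 ℤ.* h (suc k) ℤ.+ (f 0 ℤ.* (tail g ⊛ h) k ℤ.+ (tail f ⊛ (g ⊛ h)) k)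
    ≡⟨ lemma (f 0) (g 0) (h (suc k)) _ _ ⟩
  f 0 ℤ.* (g 0 ℤ.* h (suc k) ℤ.+ (tail g ⊛ h) k) ℤ.+ (tail f ⊛ (g ⊛ h)) k
    ≡⟨ cong (λ x → f 0 ℤ.* x ℤ.+ (tail f ⊛ (g ⊛ h)) k) (⊛-suc g h k) ⟨
  f 0 ℤ.* (g ⊛ h) (suc k) ℤ.+ (tail f ⊛ (g ⊛ h)) k
    ≡⟨ ⊛-suc f (g ⊛ h) k ⟨
  (f ⊛ (g ⊛ h)) (suc k) ∎
  where
  open ≡-Reasoning
  lemma : ∀ a b c d e → a ℤ.* b ℤ.* c ℤ.+ (a ℤ.* d ℤ.+ e) ≡ a ℤ.* (b ℤ.* c ℤ.+ d) ℤ.+ e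
  lemma = ℤ-Ring.solve-∀

⊛-identityˡ : ∀ f → cst (+ 1) ⊛ f ≋ f
⊛-identityˡ f .at k = trans (cst⊛ (+ 1) f k) (ℤₚ.*-identityˡ (f k))

cst0 : ∀ k → cst (+ 0) k ≡ + 0
cst0 zero    = refl
cst0 (suc k) = refl

PS-commutativeRing : CommutativeRing _ _
PS-commutativeRing = record
  { Carrier = PS ; _≈_ = _≋_ ; _+_ = _⊕_ ; _*_ = _⊛_ ; -_ = neg ; 0# = cst (+ 0) ; 1# = cst (+ 1)
  ; isCommutativeRing = record
    { isRing = record
      { +-isAbelianGroup = record
        { isGroup = record
          { isMonoid = record
            { isSemigroup = record
              { isMagma = record
                { isEquivalence = record
                  { refl  = coeffwise λ _ → refl
                  ; sym   = λ p → coeffwise λ k → sym (at p k)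
                  ; trans = λ p q → coeffwise λ k → trans (at p k) (at q k)
                  }
                ; ∙-cong = λ p q → coeffwise λ k → cong₂ ℤ._+_ (at p k) (at q k)
                }
              ; assoc = λ f g h → coeffwise λ k → ℤₚ.+-assoc (f k) (g k) (h k)
              }
            ; identity = (λ f → coeffwise λ k → trans (cong (ℤ._+ f k) (cst0 k)) (ℤₚ.+-identityˡ (f k)))
                       , (λ f → coeffwise λ k → trans (cong (λ x → f k ℤ.+ x) (cst0 k)) (ℤₚ.+-identityʳ (f k)))
            }
          ; inverse = (λ f → coeffwise λ k → trans (ℤₚ.+-inverseˡ (f k)) (sym (cst0 k)))
                    , (λ f → coeffwise λ k → trans (ℤₚ.+-inverseʳ (f k)) (sym (cst0 k)))
          ; ⁻¹-cong = λ p → coeffwise λ k → cong ℤ.-_ (at p k)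
          }
        ; comm = λ f g → coeffwise λ k → ℤₚ.+-comm (f k) (g k)
        }
      ; *-cong = ⊛-cong
      ; *-assoc = ⊛-assoc
      ; *-identity = ⊛-identityˡ , λ f → coeffwise λ k → trans (at (⊛-comm f (cst (+ 1))) k) (at (⊛-identityˡ f) k)
      ; distrib = (λ h f g → coeffwise λ k → trans (at (⊛-comm h (f ⊕ g)) k)
                    (trans (at (⊛-distribʳ h f g) k) (cong₂ ℤ._+_ (at (⊛-comm f h) k) (at (⊛-comm g h) k))))
                , ⊛-distribʳ
      }
    ; *-comm = ⊛-comm
    }
  }

private
  PS-almostCommutativeRing : AlmostCommutativeRing _ _
  PS-almostCommutativeRing = fromCommutativeRing PS-commutativeRing

  cst-homomorphism : ℤ.+-*-rawRing -Raw-AlmostCommutative⟶ PS-almostCommutativeRing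
  cst-homomorphism = record
    { ⟦_⟧    = cst
    ; +-homo = λ x y → coeffwise λ { zero → refl ; (suc k) → refl }
    ; *-homo = λ x y → coeffwise λ { zero → sym (cst⊛ x (cst y) zero)
                                   ; (suc k) → sym (trans (cst⊛ x (cst y) (suc k)) (ℤₚ.*-zeroʳ x)) }
    ; -‿homo = λ x → coeffwise λ { zero → refl ; (suc k) → refl }
    ; 0-homo = coeffwise λ _ → refl
    ; 1-homo = coeffwise λ _ → refl
    }

  _coeff≟_ : WeaklyDecidable (Induced-equivalence cst-homomorphism)
  x coeff≟ y with x ℤₚ.≟ y
  ... | yes refl = just (coeffwise λ _ → refl)
  ... | no _     = nothing

module PS-Solver = Algebra.Solver.Ring ℤ.+-*-rawRing PS-almostCommutativeRing cst-homomorphism _coeff≟_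
open PS-Solver using (solve; _:=_; _:+_; _:*_; _:-_; con)
module PSR = CommutativeRing PS-commutativeRing
open Relation.Binary.Reasoning.Setoid PSR.setoid

⊕-cong : ∀ {f f′ g g′} → f ≋ f′ → g ≋ g′ → f ⊕ g ≋ f′ ⊕ g′
⊕-cong = PSR.+-cong

X⊛-suc : ∀ f k → (X ⊛ f) (suc k) ≡ f k
X⊛-suc f k = trans (⊛-suc X f k) (trans (ℤₚ.+-identityˡ ((tail X ⊛ f) k))
  (trans (⊛-cong-≤ {tail X} {cst (+ 1)} {f} k (λ { zero _ → refl ; (suc i) _ → refl }) (λ _ _ → refl)) (at (⊛-identityˡ f) k)))

-- The Catalan series and the square root of 1 - 4x

1-4X : PS
1-4X = cst (+ 1) ⊖ cst (+ 4) ⊛ X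

-- The iterates of c ↦ 1 + X c², whose coefficient at k is stationary from the k-th iterate on.
catalanApprox : ℕ → PS
catalanApprox zero    = cst (+ 1)
catalanApprox (suc n) = cst (+ 1) ⊕ X ⊛ (catalanApprox n ⊛ catalanApprox n)

catalan : PS
catalan k = catalanApprox k k

catalanApprox-suc : ∀ n k → k ≤ n → catalanApprox (suc n) k ≡ catalanApprox n k
catalanApprox-suc zero    zero    _ = refl
catalanApprox-suc (suc n) zero    _ = refl
catalanApprox-suc (suc n) (suc k) (s≤s k≤n) = cong (λ x → + 0 ℤ.+ x)
  (trans (X⊛-suc (catalanApprox (suc n) ⊛ catalanApprox (suc n)) k)
    (trans (⊛-cong-≤ k stable stable) (sym (X⊛-suc (catalanApprox n ⊛ catalanApprox n) k))))
  where
  stable : ∀ i → i ≤ k → catalanApprox (suc n) i ≡ catalanApprox n i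
  stable i i≤k = catalanApprox-suc n i (≤-trans i≤k k≤n)

catalanApprox-stable : ∀ {n} k → k ≤′ n → catalanApprox n k ≡ catalan k
catalanApprox-stable k (≤′-reflexive refl) = refl
catalanApprox-stable {suc n} k (≤′-step k≤n) =
  trans (catalanApprox-suc n k (≤′⇒≤ k≤n)) (catalanApprox-stable k k≤n)

catalan-eq : catalan ≋ cst (+ 1) ⊕ X ⊛ (catalan ⊛ catalan)
catalan-eq .at zero    = refl
catalan-eq .at (suc k) = cong (λ x → + 0 ℤ.+ x)
  (trans (X⊛-suc (catalanApprox k ⊛ catalanApprox k) k)
    (trans (⊛-cong-≤ k stable stable) (sym (X⊛-suc (catalan ⊛ catalan) k))))
  where
  stable : ∀ i → i ≤ k → catalanApprox k i ≡ catalan i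
  stable i i≤k = catalanApprox-stable i (≤⇒≤′ i≤k)

-- Written as a vanishing series, the quadratic equation can enter a polynomial identity as an
-- explicit multiple of the defect, which is then replaced by 0.
catalan-defect : catalan ⊖ cst (+ 1) ⊖ X ⊛ (catalan ⊛ catalan) ≋ cst (+ 0)
catalan-defect = begin
  catalan ⊖ cst (+ 1) ⊖ X ⊛ (catalan ⊛ catalan)
    ≈⟨ ⊕-cong (⊕-cong catalan-eq (PSR.refl {neg (cst (+ 1))})) (PSR.refl {neg (X ⊛ (catalan ⊛ catalan))}) ⟩
  (cst (+ 1) ⊕ X ⊛ (catalan ⊛ catalan)) ⊖ cst (+ 1) ⊖ X ⊛ (catalan ⊛ catalan)
    ≈⟨ solve 1 (λ y → con (+ 1) :+ y :- con (+ 1) :- y := con (+ 0)) PSR.refl (X ⊛ (catalan ⊛ catalan)) ⟩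
  cst (+ 0) ∎

-- The Catalan series c is (1 - √(1-4x)) / 2x; solving for the root avoids both divisions.
√1-4X : PS
√1-4X = cst (+ 1) ⊖ cst (+ 2) ⊛ (X ⊛ catalan)

√1-4X-square : √1-4X ⊛ √1-4X ≋ 1-4X
√1-4X-square = begin
  √1-4X ⊛ √1-4X
    ≈⟨ solve 2 (λ x c →
         (con (+ 1) :- con (+ 2) :* (x :* c)) :* (con (+ 1) :- con (+ 2) :* (x :* c))
         := con (+ 1) :- con (+ 4) :* x :- con (+ 4) :* x :* (c :- con (+ 1) :- x :* (c :* c)))
         PSR.refl X catalan ⟩
  1-4X ⊖ cst (+ 4) ⊛ X ⊛ (catalan ⊖ cst (+ 1) ⊖ X ⊛ (catalan ⊛ catalan))
    ≈⟨ ⊕-cong (PSR.refl {1-4X}) (PSR.-‿cong (⊛-cong (PSR.refl {cst (+ 4) ⊛ X}) catalan-defect)) ⟩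
  1-4X ⊖ cst (+ 4) ⊛ X ⊛ cst (+ 0)
    ≈⟨ solve 2 (λ p x → p :- con (+ 4) :* x :* con (+ 0) := p) PSR.refl 1-4X X ⟩
  1-4X ∎

⊛-vanish : ∀ f {g} k → (∀ i → i ≤ k → g i ≡ + 0) → (f ⊛ g) k ≡ + 0
⊛-vanish f {g} k g≡0 = trans
  (⊛-cong-≤ {f} {f} {g} {cst (+ 0)} k (λ _ _ → refl) (λ i i≤k → trans (g≡0 i i≤k) (sym (cst0 i))))
  (trans (at (PSR.zeroʳ f) k) (cst0 k))

⊛-cancelʳ-zero : ∀ {f g} → g 0 ≢ + 0 → f ⊛ g ≋ cst (+ 0) → f ≋ cst (+ 0)
⊛-cancelʳ-zero {f} {g} g₀≢0 fg≋0 .at k = trans (<-rec (λ k → f k ≡ + 0) step k) (sym (cst0 k))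
  where
  fg≡0 : ∀ k → (f ⊛ g) k ≡ + 0
  fg≡0 k = trans (at fg≋0 k) (cst0 k)

  cancel : ∀ x → x ℤ.* g 0 ≡ + 0 → x ≡ + 0
  cancel x xg≡0 = [ id , ⊥-elim ∘ g₀≢0 ]′ (ℤₚ.i*j≡0⇒i≡0∨j≡0 x xg≡0)

  step : ∀ k → (∀ {i} → i < k → f i ≡ + 0) → f k ≡ + 0
  step zero    _     = cancel (f 0) (trans (sym (⊛-zero f g)) (fg≡0 0))
  step (suc k) below = cancel (f (suc k)) (trans (sym (trans
    (⊛-sucʳ f g k)
    (trans (cong (ℤ._+ f (suc k) ℤ.* g 0)
             (trans (at (⊛-comm f (tail g)) k) (⊛-vanish (tail g) k (λ i i≤k → below (s≤s i≤k)))))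
      (ℤₚ.+-identityˡ (f (suc k) ℤ.* g 0)))))
    (fg≡0 (suc k)))

-- From (s - t)(s + t) = 0 the second factor is cancelled: its constant term is 2.
√1-4X-unique : ∀ s → s 0 ≡ + 1 → s ⊛ s ≋ 1-4X → s ≋ √1-4X
√1-4X-unique s s₀≡1 s²≋ = begin
  s                    ≈⟨ solve 2 (λ s t → s := (s :- t) :+ t) PSR.refl s √1-4X ⟩
  (s ⊖ √1-4X) ⊕ √1-4X  ≈⟨ ⊕-cong (⊛-cancelʳ-zero {s ⊖ √1-4X} {s ⊕ √1-4X} sum₀≢0 product) (PSR.refl {√1-4X}) ⟩
  cst (+ 0) ⊕ √1-4X    ≈⟨ PSR.+-identityˡ √1-4X ⟩
  √1-4X                ∎
  where
  sum₀≢0 : (s ⊕ √1-4X) 0 ≢ + 0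
  sum₀≢0 rewrite s₀≡1 = λ ()

  product : (s ⊖ √1-4X) ⊛ (s ⊕ √1-4X) ≋ cst (+ 0)
  product = begin
    (s ⊖ √1-4X) ⊛ (s ⊕ √1-4X)
      ≈⟨ solve 2 (λ s t → (s :- t) :* (s :+ t) := s :* s :- t :* t) PSR.refl s √1-4X ⟩
    s ⊛ s ⊖ √1-4X ⊛ √1-4X
      ≈⟨ ⊕-cong s²≋ (PSR.-‿cong √1-4X-square) ⟩
    1-4X ⊖ 1-4X
      ≈⟨ PSR.-‿inverseʳ 1-4X ⟩
    cst (+ 0) ∎

-- The kernel method for the walk

-- The generating function, by number of steps, of the reflected lazy walks from `m` to 0.
walks : ℕ → PS
walks m k = + Δ^ k δ₀ m

walks-zero : walks 0 ≋ cst (+ 1) ⊕ X ⊛ (cst (+ 2) ⊛ walks 0 ⊕ cst (+ 2) ⊛ walks 1)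
walks-zero .at zero    = refl
walks-zero .at (suc k) = sym (trans (ℤₚ.+-identityˡ _)
  (trans (X⊛-suc (cst (+ 2) ⊛ walks 0 ⊕ cst (+ 2) ⊛ walks 1) k)
    (cong₂ ℤ._+_ (double 0) (double 1))))
  where
  double : ∀ m → (cst (+ 2) ⊛ walks m) k ≡ + (2 * Δ^ k δ₀ m)
  double m = trans (cst⊛ (+ 2) (walks m) k) (sym (ℤₚ.pos-* 2 (Δ^ k δ₀ m)))

walks-suc : ∀ m → walks (suc m) ≋ X ⊛ (walks m ⊕ cst (+ 2) ⊛ walks (suc m) ⊕ walks (suc (suc m)))
walks-suc m .at zero    = refl
walks-suc m .at (suc k) = sym (trans
  (X⊛-suc (walks m ⊕ cst (+ 2) ⊛ walks (suc m) ⊕ walks (suc (suc m))) k)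
  (cong (λ x → walks m k ℤ.+ x ℤ.+ walks (suc (suc m)) k)
    (trans (cst⊛ (+ 2) (walks (suc m)) k) (sym (ℤₚ.pos-* 2 (Δ^ k δ₀ (suc m)))))))

-- The kernel X (1 + y)² − y vanishes at y = X c², so walks (m + 1) should be y times walks m;
-- the defect satisfies a homogeneous linear recurrence with a factor X, hence is zero.
ratioDefect : ℕ → PS
ratioDefect m = walks (suc m) ⊖ X ⊛ (catalan ⊛ catalan) ⊛ walks m

-- Dividing the walk recurrence by the factor of its kernel that belongs to the root y = x c² leaves
-- x d_{m+1} = (1 - 2x - x y) d_m for the defects d_m. Since c = 1 + y, this is the form below.
ratioDefect-eq : ∀ m → ratioDefect m ≋
  X ⊛ (ratioDefect (suc m) ⊕ ratioDefect m ⊕ catalan ⊛ ratioDefect m)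
ratioDefect-eq m = PSR.sym (begin
  X ⊛ (ratioDefect (suc m) ⊕ ratioDefect m ⊕ catalan ⊛ ratioDefect m)
    ≈⟨ solve 5 (λ x c u₀ u₁ u₂ →
         let y = x :* (c :* c)
             d₀ = u₁ :- y :* u₀
             d₁ = u₂ :- y :* u₁
         in x :* (d₁ :+ d₀ :+ c :* d₀)
            := x :* (u₀ :+ con (+ 2) :* u₁ :+ u₂) :- y :* u₀
               :+ (x :* u₁ :+ x :* u₀ :* (c :+ con (+ 1))) :* (c :- con (+ 1) :- y))
         PSR.refl X catalan (walks m) (walks (suc m)) (walks (suc (suc m))) ⟩
  X ⊛ (walks m ⊕ cst (+ 2) ⊛ walks (suc m) ⊕ walks (suc (suc m))) ⊖ ratio ⊛ walks m
    ⊕ coeff ⊛ (catalan ⊖ cst (+ 1) ⊖ ratio)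
    ≈⟨ ⊕-cong (⊕-cong (PSR.sym (walks-suc m)) (PSR.refl {neg (ratio ⊛ walks m)}))
         (PSR.trans (⊛-cong (PSR.refl {coeff}) catalan-defect) (PSR.zeroʳ coeff)) ⟩
  ratioDefect m ⊕ cst (+ 0)
    ≈⟨ PSR.+-identityʳ (ratioDefect m) ⟩
  ratioDefect m ∎)
  where
  ratio = X ⊛ (catalan ⊛ catalan)
  coeff = X ⊛ walks (suc m) ⊕ X ⊛ walks m ⊛ (catalan ⊕ cst (+ 1))

ratioDefect-vanishes : ∀ m → ratioDefect m ≋ cst (+ 0)
ratioDefect-vanishes m .at k =
  -- All `m` are treated at once: degree `k` at `m` uses a lower degree at `suc m`.
  trans (<-rec (λ k → ∀ m → ratioDefect m k ≡ + 0) step k m) (sym (cst0 k))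
  where
  step : ∀ k → (∀ {i} → i < k → ∀ m → ratioDefect m i ≡ + 0) → ∀ m → ratioDefect m k ≡ + 0
  step zero    _     m = trans (at (ratioDefect-eq m) 0)
    (⊛-zero X (ratioDefect (suc m) ⊕ ratioDefect m ⊕ catalan ⊛ ratioDefect m))
  step (suc k) below m = trans (at (ratioDefect-eq m) (suc k))
    (trans (X⊛-suc (ratioDefect (suc m) ⊕ ratioDefect m ⊕ catalan ⊛ ratioDefect m) k)
      (cong₂ ℤ._+_
        (cong₂ ℤ._+_ (below ≤-refl (suc m)) (below ≤-refl m))
        (⊛-vanish catalan k (λ i i≤k → below (s≤s i≤k) m))))

-- With `walks 1` equal to y Z, a first-step analysis at 0 gives Z (1 - 2x (1 + y)) = 1, and 1 + y =
-- c.
walks-√ : walks 0 ⊛ √1-4X ≋ cst (+ 1)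
walks-√ = begin
  Z ⊛ √1-4X
    ≈⟨ ⊛-cong walks-zero (PSR.refl {√1-4X}) ⟩
  (cst (+ 1) ⊕ X ⊛ (cst (+ 2) ⊛ Z ⊕ cst (+ 2) ⊛ walks 1)) ⊛ √1-4X
    -- The three correction terms are multiples of the ratio defect, the Catalan defect and the
    -- defect of `walks-zero`.
    ≈⟨ solve 4 (λ x c z u →
         let w = con (+ 1) :+ x :* (con (+ 2) :* z :+ con (+ 2) :* u)
             y = x :* (c :* c)
         in w :* (con (+ 1) :- con (+ 2) :* (x :* c))
            := con (+ 1)
               :+ con (+ 2) :* x :* (u :- y :* z)
               :- con (+ 2) :* x :* z :* (c :- con (+ 1) :- y)
               :+ con (+ 2) :* x :* c :* (z :- w))
         PSR.refl X catalan Z (walks 1) ⟩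
  cst (+ 1) ⊕ cst (+ 2) ⊛ X ⊛ ratioDefect 0 ⊖ cst (+ 2) ⊛ X ⊛ Z ⊛ (catalan ⊖ cst (+ 1) ⊖ X ⊛ (catalan ⊛ catalan))
    ⊕ cst (+ 2) ⊛ X ⊛ catalan ⊛ (Z ⊖ (cst (+ 1) ⊕ X ⊛ (cst (+ 2) ⊛ Z ⊕ cst (+ 2) ⊛ walks 1)))
    ≈⟨ ⊕-cong (⊕-cong (⊕-cong (PSR.refl {cst (+ 1)})
         (⊛-cong (PSR.refl {cst (+ 2) ⊛ X}) (ratioDefect-vanishes 0)))
         (PSR.-‿cong (⊛-cong (PSR.refl {cst (+ 2) ⊛ X ⊛ Z}) catalan-defect)))
         (⊛-cong (PSR.refl {cst (+ 2) ⊛ X ⊛ catalan})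
           (PSR.trans (⊕-cong (PSR.refl {Z}) (PSR.-‿cong (PSR.sym walks-zero))) (PSR.-‿inverseʳ Z))) ⟩
  cst (+ 1) ⊕ cst (+ 2) ⊛ X ⊛ cst (+ 0) ⊖ cst (+ 2) ⊛ X ⊛ Z ⊛ cst (+ 0) ⊕ cst (+ 2) ⊛ X ⊛ catalan ⊛ cst (+ 0)
    ≈⟨ solve 3 (λ x c z → con (+ 1) :+ con (+ 2) :* x :* con (+ 0) :- con (+ 2) :* x :* z :* con (+ 0)
         :+ con (+ 2) :* x :* c :* con (+ 0) := con (+ 1)) PSR.refl X catalan Z ⟩
  cst (+ 1) ∎
  where
  Z = walks 0

-- The closed form

countGaps : PS
countGaps k = + Δ^ k id 0

cst⊛X⊛-suc : ∀ c (f : ℕ → ℕ) k → (cst (+ c) ⊛ (X ⊛ (λ i → + f i))) (suc k) ≡ + (c * f k)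
cst⊛X⊛-suc c f k = trans (cst⊛ (+ c) (X ⊛ (λ i → + f i)) (suc k))
  (trans (cong (λ x → + c ℤ.* x) (X⊛-suc (λ i → + f i) k)) (sym (ℤₚ.pos-* c (f k))))

countGaps-eq : countGaps ≋ cst (+ 4) ⊛ (X ⊛ countGaps) ⊕ cst (+ 2) ⊛ (X ⊛ walks 0)
countGaps-eq .at zero    = refl
countGaps-eq .at (suc k) = trans (cong +_ (Δ^-id-suc k 0)) (sym (cong₂ ℤ._+_
  (cst⊛X⊛-suc 4 (λ k → Δ^ k id 0) k) (cst⊛X⊛-suc 2 (λ k → Δ^ k δ₀ 0) k)))

module _ (D s : PS) (D-eq : D ≋ cst (+ 4) ⊛ (X ⊛ D) ⊕ countGaps)
         (s₀≡1 : s 0 ≡ + 1) (s²≋ : s ⊛ s ≋ 1-4X) where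

  private
    E = countGaps
    Z = walks 0

    PD≋E : 1-4X ⊛ D ≋ E
    PD≋E = begin
      1-4X ⊛ D
        ≈⟨ solve 2 (λ x d → (con (+ 1) :- con (+ 4) :* x) :* d := d :- con (+ 4) :* (x :* d)) PSR.refl X D ⟩
      D ⊖ cst (+ 4) ⊛ (X ⊛ D)
        ≈⟨ ⊕-cong D-eq (PSR.refl {neg (cst (+ 4) ⊛ (X ⊛ D))}) ⟩
      cst (+ 4) ⊛ (X ⊛ D) ⊕ E ⊖ cst (+ 4) ⊛ (X ⊛ D)
        ≈⟨ solve 2 (λ a e → a :+ e :- a := e) PSR.refl (cst (+ 4) ⊛ (X ⊛ D)) E ⟩
      E ∎

    PE≋2XZ : 1-4X ⊛ E ≋ cst (+ 2) ⊛ (X ⊛ Z)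
    PE≋2XZ = begin
      1-4X ⊛ E
        ≈⟨ solve 2 (λ x d → (con (+ 1) :- con (+ 4) :* x) :* d := d :- con (+ 4) :* (x :* d)) PSR.refl X E ⟩
      E ⊖ cst (+ 4) ⊛ (X ⊛ E)
        ≈⟨ ⊕-cong countGaps-eq (PSR.refl {neg (cst (+ 4) ⊛ (X ⊛ E))}) ⟩
      cst (+ 4) ⊛ (X ⊛ E) ⊕ cst (+ 2) ⊛ (X ⊛ Z) ⊖ cst (+ 4) ⊛ (X ⊛ E)
        ≈⟨ solve 2 (λ a e → a :+ e :- a := e) PSR.refl (cst (+ 4) ⊛ (X ⊛ E)) (cst (+ 2) ⊛ (X ⊛ Z)) ⟩
      cst (+ 2) ⊛ (X ⊛ Z) ∎

    Zs≋1 : Z ⊛ s ≋ cst (+ 1)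
    Zs≋1 = PSR.trans (⊛-cong (PSR.refl {Z}) (√1-4X-unique s s₀≡1 s²≋)) walks-√

    1+s : PS
    1+s = cst (+ 1) ⊕ s

  -- Replacing 1-4x+s by s(1+s) supplies three powers of s beside (1+s)³. Two of them form a factor
  -- 1-4x, which with the one already present turns `D` into `E` and `E` into 2xZ; the third cancels
  -- Z. What remains is 2x (1+s)³, and s² = 1-4x reduces it to the right-hand side.
  closedForm : D ⊛ (1-4X ⊛ ((1-4X ⊕ s) ⊛ (1-4X ⊕ s) ⊛ (1-4X ⊕ s)))
               ≋ cst (+ 8) ⊛ X ⊛ (cst (+ 1) ⊕ s ⊖ X ⊛ (cst (+ 3) ⊕ s))
  closedForm = begin
    D ⊛ (1-4X ⊛ ((1-4X ⊕ s) ⊛ (1-4X ⊕ s) ⊛ (1-4X ⊕ s)))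
      ≈⟨ ⊛-cong (PSR.refl {D}) (⊛-cong (PSR.refl {1-4X}) (⊛-cong (⊛-cong Q≋ Q≋) Q≋)) ⟩
    D ⊛ (1-4X ⊛ ((s ⊛ s ⊕ s) ⊛ (s ⊛ s ⊕ s) ⊛ (s ⊛ s ⊕ s)))
      ≈⟨ solve 3 (λ d p s → d :* (p :* ((s :* s :+ s) :* (s :* s :+ s) :* (s :* s :+ s)))
           := (p :* d) :* ((s :* s) :* (s :* ((con (+ 1) :+ s) :* (con (+ 1) :+ s) :* (con (+ 1) :+ s)))))
           PSR.refl D 1-4X s ⟩
    (1-4X ⊛ D) ⊛ ((s ⊛ s) ⊛ (s ⊛ (1+s ⊛ 1+s ⊛ 1+s)))
      ≈⟨ ⊛-cong PD≋E (⊛-cong s²≋ (PSR.refl {s ⊛ (1+s ⊛ 1+s ⊛ 1+s)})) ⟩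
    E ⊛ (1-4X ⊛ (s ⊛ (1+s ⊛ 1+s ⊛ 1+s)))
      ≈⟨ solve 4 (λ e p s t → e :* (p :* (s :* t)) := (p :* e) :* (s :* t)) PSR.refl E 1-4X s (1+s ⊛ 1+s ⊛ 1+s) ⟩
    (1-4X ⊛ E) ⊛ (s ⊛ (1+s ⊛ 1+s ⊛ 1+s))
      ≈⟨ ⊛-cong PE≋2XZ (PSR.refl {s ⊛ (1+s ⊛ 1+s ⊛ 1+s)}) ⟩
    (cst (+ 2) ⊛ (X ⊛ Z)) ⊛ (s ⊛ (1+s ⊛ 1+s ⊛ 1+s))
      ≈⟨ solve 3 (λ x z s → (con (+ 2) :* (x :* z)) :* (s :* ((con (+ 1) :+ s) :* (con (+ 1) :+ s) :* (con (+ 1) :+ s)))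
           := (con (+ 2) :* x) :* ((z :* s) :* (con (+ 1) :+ con (+ 3) :* s :+ con (+ 3) :* (s :* s) :+ (s :* s) :* s)))
           PSR.refl X Z s ⟩
    (cst (+ 2) ⊛ X) ⊛ ((Z ⊛ s) ⊛ (cst (+ 1) ⊕ cst (+ 3) ⊛ s ⊕ cst (+ 3) ⊛ (s ⊛ s) ⊕ (s ⊛ s) ⊛ s))
      ≈⟨ ⊛-cong (PSR.refl {cst (+ 2) ⊛ X}) (⊛-cong Zs≋1
           (⊕-cong (⊕-cong (PSR.refl {cst (+ 1) ⊕ cst (+ 3) ⊛ s}) (⊛-cong (PSR.refl {cst (+ 3)}) s²≋))
             (⊛-cong s²≋ (PSR.refl {s})))) ⟩
    (cst (+ 2) ⊛ X) ⊛ (cst (+ 1) ⊛ (cst (+ 1) ⊕ cst (+ 3) ⊛ s ⊕ cst (+ 3) ⊛ 1-4X ⊕ 1-4X ⊛ s))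
      ≈⟨ solve 2 (λ x s → let p = con (+ 1) :- con (+ 4) :* x in
           (con (+ 2) :* x) :* (con (+ 1) :* (con (+ 1) :+ con (+ 3) :* s :+ con (+ 3) :* p :+ p :* s))
           := con (+ 8) :* x :* (con (+ 1) :+ s :- x :* (con (+ 3) :+ s)))
           PSR.refl X s ⟩
    cst (+ 8) ⊛ X ⊛ (cst (+ 1) ⊕ s ⊖ X ⊛ (cst (+ 3) ⊕ s)) ∎
    where
    Q≋ : 1-4X ⊕ s ≋ s ⊛ s ⊕ s
    Q≋ = ⊕-cong (PSR.sym s²≋) (PSR.refl {s})

genQ-eq : genQ ≋ cst (+ 4) ⊛ (X ⊛ genQ) ⊕ countGaps
genQ-eq .at zero    = cong +_ (dQ≡sumPairs 0)
genQ-eq .at (suc k) = trans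
  (cong +_ (trans (dQ≡sumPairs (suc k))
    (trans (sumPairs-gap k) (cong (λ d → 4 * d + Δ^ (suc k) id 0) (sym (dQ≡sumPairs k))))))
  (cong (ℤ._+ countGaps (suc k)) (sym (cst⊛X⊛-suc 4 dQ k)))

-- The quotient is stated by cross-multiplication. The constant term of the denominator is 8, no
-- unit of ℤ but nonzero, so the equation determines `genQ`. The first component shows that the
-- square root exists with integer coefficients, so that the second is not vacuous.
theorem1p7 : Σ PS (λ s → (s 0 ≡ + 1) × (∀ k → (s ⊛ s) k ≡ (cst (+ 1) ⊖ cst (+ 4) ⊛ X) k))
    × (∀ (s : PS) → s 0 ≡ + 1
    → (∀ k → (s ⊛ s) k ≡ (cst (+ 1) ⊖ cst (+ 4) ⊛ X) k)
    → ∀ k →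
    (genQ ⊛ ((cst (+ 1) ⊖ cst (+ 4) ⊛ X)
    ⊛ ((cst (+ 1) ⊖ cst (+ 4) ⊛ X ⊕ s)
    ⊛ (cst (+ 1) ⊖ cst (+ 4) ⊛ X ⊕ s)
    ⊛ (cst (+ 1) ⊖ cst (+ 4) ⊛ X ⊕ s)))) k
    ≡ (cst (+ 8) ⊛ X ⊛ (cst (+ 1) ⊕ s ⊖ X ⊛ (cst (+ 3) ⊕ s))) k)
theorem1p7 = (√1-4X , refl , at √1-4X-square)
  , λ s s₀≡1 s²≡ → at (closedForm genQ s genQ-eq s₀≡1 (coeffwise s²≡))
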